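{- As $X\to\infty$, we have $$N_3'(X)=N_3(X)+O(X^{1/6}\log X).$$
   Context: $\mathcal{E}$ is the set of elliptic curves over $\mathbb{Q}$ given by equations $E_{A,B}\colon y^2=x^3+Ax+B$ with $A,B\in\mathbb{Z}$, $4A^3+27B^2\ne0$, and such that there is no prime $\ell$ with both $\ell^4\mid A$ and $\ell^6\mid B$; every elliptic curve over $\mathbb{Q}$ is isomorphic over $\mathbb{Q}$ to exactly one member of $\mathcal{E}$. The height is $\operatorname{ht}(E_{A,B})=\max(|4A^3|,|27B^2|)$, and $\mathcal{E}_{\le X}=\{E\in\mathcal{E}:\operatorname{ht}(E)\le X\}$. A $3$-isogeny is an isogeny of degree $3$. $N_3(X)$ is the number of $E\in\mathcal{E}_{\le X}$ that have a $3$-isogeny defined over $\mathbb{Q}$. $N_3'(X)$ is the number of pairs $(E,\phi)$ with $E\in\mathcal{E}_{\le X}$ and $\phi\colon E\to E'$ a $3$-isogeny defined over $\mathbb{Q}$, where isogenies from $E$ with the same kernel are identified (so that one counts pairs $(E,C)$ with $C\subset E(\overline{\mathbb{Q}})$ a $\operatorname{Gal}(\overline{\mathbb{Q}}/\mathbb{Q})$-stable subgroup of order $3$). -}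

module Defs where

open import Algebra.Bundles using (CommutativeRing)
open import Algebra.Morphism.Structures using (module RingMorphisms)
open import Data.Fin.Base using (Fin)
open import Data.Integer.Base as ℤ using (ℤ; +_) hiding (module ℤ)
open import Data.Integer.Divisibility using (_∣_)
open import Data.List.Base using (List; []; _∷_; map)
open import Data.Maybe.Base as Maybe using (Maybe; just; nothing) hiding (module Maybe)
import Data.Maybe.Relation.Binary.Pointwise as Maybe
open import Data.Nat.Base as ℕ using (ℕ) hiding (module ℕ)
open import Data.Nat.Logarithm using (⌊log₂_⌋)
open import Data.Nat.Primality using (Prime)
open import Data.Product.Base as Product using (Σ; ∃; ∃-syntax; _×_; _,_; proj₁; proj₂)
open import Data.Product.Relation.Binary.Pointwise.NonDependent using (×-setoid)
open import Data.Rational.Base as ℚ using (ℚ) hiding (module ℚ)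
open import Data.Unit.Base using (⊤)
open import Function.Bundles using (Inverse)
open import Level using (Level; 0ℓ) renaming (suc to lsuc)
open import Relation.Binary.Bundles using (Setoid)
import Relation.Binary.Construct.On as On
open import Relation.Binary.Definitions using (Decidable; _Respects_)
open import Relation.Binary.PropositionalEquality using (_≡_; _≢_; setoid)
open import Relation.Nullary using (¬_; yes; no)
open import Relation.Unary using (Pred; _∈_)
open import Relation.Unary.Relation.Binary.Equality using (≐-setoid)

HasCardinality : ∀ {a ℓ : Level} → Setoid a ℓ → ℕ → Set _
HasCardinality S n = Inverse (setoid (Fin n)) S

------------------------------------------------------------------------
-- An algebraic closure of ℚ

module _ (R : CommutativeRing 0ℓ 0ℓ) where
  open CommutativeRing R

  -- monic (c₀ ∷ … ∷ cₙ₋₁ ∷ []) x = c₀ + c₁ x + … + cₙ₋₁ xⁿ⁻¹ + xⁿ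
  monic : List Carrier → Carrier → Carrier
  monic []       x = 1#
  monic (c ∷ cs) x = c + x * monic cs x

  IsAutomorphism : (Carrier → Carrier) → Set
  IsAutomorphism = RingMorphisms.IsRingIsomorphism rawRing rawRing

record AlgebraicClosureOfℚ : Set₁ where
  infix 4 _≟_
  infix 9 _⁻¹

  field
    commutativeRing : CommutativeRing 0ℓ 0ℓ

  open CommutativeRing commutativeRing public

  field
    _≟_       : Decidable _≈_
    1≉0       : ¬ (1# ≈ 0#)
    -- The value 0# ⁻¹ is unconstrained; it is never used.
    _⁻¹       : Carrier → Carrier
    *-inverse : ∀ x → ¬ (x ≈ 0#) → x * x ⁻¹ ≈ 1#

    ι                : ℚ → Carrier
    ι-isHomomorphism : RingMorphisms.IsRingHomomorphism ℚ.+-*-rawRing rawRing ι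

    algebraicallyClosed : ∀ c cs → ∃[ x ] monic commutativeRing (c ∷ cs) x ≈ 0#

    -- cs = [] is harmless here, since monic [] x = 1#.
    algebraic : ∀ x → ∃[ cs ] monic commutativeRing (map ι cs) x ≈ 0#

    -- The extension is Galois: the fixed field of Gal(K/ℚ) is ℚ.  For an
    -- algebraic closure of ℚ this is classically automatic; it is what makes
    -- Gal(K/ℚ), the group of all ring automorphisms of K (these fix ℚ
    -- pointwise), the absolute Galois group.
    galois : ∀ x → (∀ σ → IsAutomorphism commutativeRing σ → σ x ≈ x) →
             ∃[ q ] ι q ≈ x

  fromℤ : ℤ → Carrier
  fromℤ n = ι (n ℚ./ 1)

------------------------------------------------------------------------
-- Integral models, one for each ℚ-isomorphism class of elliptic curves

record 𝓔 : Set where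
  open ℤ using (_+_; _*_; _^_)
  field
    A B         : ℤ
    nonsingular : + 4 * A ^ 3 + + 27 * B ^ 2 ≢ + 0
    minimal     : ∀ ℓ → Prime ℓ → ¬ ((+ ℓ) ^ 4 ∣ A × (+ ℓ) ^ 6 ∣ B)

coefficients : 𝓔 → ℤ × ℤ
coefficients E = 𝓔.A E , 𝓔.B E

𝓔-setoid : Setoid 0ℓ 0ℓ
𝓔-setoid = On.setoid (setoid (ℤ × ℤ)) coefficients

ht : 𝓔 → ℕ
ht E = ℤ.∣ + 4 * A ^ 3 ∣ ⊔ ℤ.∣ + 27 * B ^ 2 ∣
  where
  open 𝓔 E using (A; B)
  open ℤ using (_*_; _^_)
  open ℕ using (_⊔_)

------------------------------------------------------------------------
-- Galois-stable subgroups of order 3, and the counting functions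

module _ (K : AlgebraicClosureOfℚ) where
  open AlgebraicClosureOfℚ K renaming (setoid to K-setoid)

  -- The affine plane together with the point at infinity of a Weierstrass
  -- curve; E(K) is the subset OnCurve E.
  Point : Set
  Point = Maybe (Carrier × Carrier)

  pattern ∞       = nothing
  pattern aff x y = just (x , y)

  Point-setoid : Setoid 0ℓ 0ℓ
  Point-setoid = Maybe.setoid (×-setoid K-setoid K-setoid)

  OnCurve : 𝓔 → Pred Point 0ℓ
  OnCurve E ∞         = ⊤
  OnCurve E (aff x y) =
    y * y ≈ x * x * x + fromℤ (𝓔.A E) * x + fromℤ (𝓔.B E)

  negate : Point → Point
  negate ∞         = ∞
  negate (aff x y) = aff x (- y)

  -- If the line of slope m through (x₁ , y₁) meets the curve again at
  -- abscissa x₂, this is the reflection of the third intersection point.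
  thirdPoint : (m x₁ y₁ x₂ : Carrier) → Point
  thirdPoint m x₁ y₁ x₂ = aff x₃ (m * (x₁ - x₃) - y₁)
    where
    x₃ : Carrier
    x₃ = m * m - x₁ - x₂

  -- Only meaningful on E(K): there x₁ ≈ x₂ and y₁ ≉ - y₂ force
  -- y₁ ≈ y₂ ≉ 0, which is the tangent case.
  add : 𝓔 → Point → Point → Point
  add E ∞           Q           = Q
  add E P@(aff _ _) ∞           = P
  add E (aff x₁ y₁) (aff x₂ y₂) with x₁ ≟ x₂ | y₁ ≟ - y₂
  ... | no  _ | _     = thirdPoint ((y₂ - y₁) * (x₂ - x₁) ⁻¹) x₁ y₁ x₂
  ... | yes _ | yes _ = ∞
  ... | yes _ | no  _ =
    thirdPoint ((x₁ * x₁ + x₁ * x₁ + x₁ * x₁ + fromℤ (𝓔.A E)) * (y₁ + y₁) ⁻¹)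
               x₁ y₁ x₂

  act : (Carrier → Carrier) → Point → Point
  act σ = Maybe.map (Product.map σ σ)

  record IsSubgroup (E : 𝓔) (C : Pred Point 0ℓ) : Set where
    field
      respects : C Respects (Setoid._≈_ Point-setoid)
      onCurve  : ∀ {P} → P ∈ C → P ∈ OnCurve E
      ∞∈       : ∞ ∈ C
      add∈     : ∀ {P Q} → P ∈ C → Q ∈ C → add E P Q ∈ C
      negate∈  : ∀ {P} → P ∈ C → negate P ∈ C

  subset-setoid : Pred Point 0ℓ → Setoid 0ℓ 0ℓ
  subset-setoid C = On.setoid {B = Σ Point C} Point-setoid proj₁

  IsGaloisStable : Pred Point 0ℓ → Set
  IsGaloisStable C =
    ∀ σ → IsAutomorphism commutativeRing σ → ∀ {P} → P ∈ C → act σ P ∈ C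

  -- A 3-isogeny E → E′ over ℚ, up to the identification of isogenies with
  -- equal kernel, is given by its kernel.
  record Is3IsogenyKernel (E : 𝓔) (C : Pred Point 0ℓ) : Set where
    field
      isSubgroup   : IsSubgroup E C
      order3       : HasCardinality (subset-setoid C) 3
      galoisStable : IsGaloisStable C

  CurvesWith3Isogeny : ℕ → Setoid (lsuc 0ℓ) 0ℓ
  CurvesWith3Isogeny X = On.setoid
    {B = Σ 𝓔 λ E → ht E ℕ.≤ X × ∃[ C ] Is3IsogenyKernel E C}
    𝓔-setoid proj₁

  3Isogenies : ℕ → Setoid (lsuc 0ℓ) 0ℓ
  3Isogenies X = On.setoid
    {B = Σ (𝓔 × Pred Point 0ℓ) λ (E , C) → ht E ℕ.≤ X × Is3IsogenyKernel E C}
    (×-setoid 𝓔-setoid (≐-setoid Point 0ℓ)) proj₁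

------------------------------------------------------------------------
-- f(X) = g(X) + O(X^{1/6} log X) as X → ∞

-- Both sides of |f(X) - g(X)| ≤ c X^{1/6} log X are raised to the sixth power
-- (so C plays the role of c⁶), and log X is replaced by ⌊log₂ X⌋, which is
-- within constant factors of it for X ≥ 2.
_≈_+O[X^1/6·logX] : (f g : ℕ → ℕ) → Set
f ≈ g +O[X^1/6·logX] =
  ∃[ C ] ∃[ X₀ ] ∀ X → X₀ ≤ X → ∣ f X - g X ∣ ^ 6 ≤ C * (X * ⌊log₂ X ⌋ ^ 6)
  where open ℕ using (_≤_; _*_; _^_; ∣_-_∣)

{-# OPTIONS --safe #-}
module Submission where

-- A Galois-stable subgroup of order 3 is {∞, (x, y), (x, -y)} with x a rational,
-- hence integral, root of the 3-division polynomial ψ.  So N₃′(X) counts triples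
-- (A, B, x) with ψ(x) = 0, and N₃′ - N₃ is at most the number of (A, B, u, v)
-- with roots u ≠ v of ψ.  For those, (A + 3uv)² = -3uv(u - v)², so 3|u||v| is a
-- square and 3|u| = a²n, |v| = b²n.  Since u and v are O(X^{1/6}), the number of
-- (a, b, n) is O(X^{1/6} log X), and they determine (A, B, u, v) up to signs.

open import Defs
open import Algebra.Bundles using (AbelianGroup; CommutativeRing)
open import Algebra.Morphism.Structures using (module RingMorphisms)
import Algebra.Properties.Group as GroupProperties
import Algebra.Properties.Ring as RingProperties
import Algebra.Solver.Ring as RingSolver
open import Algebra.Solver.Ring.AlmostCommutativeRing
  using (Induced-equivalence; fromCommutativeRing; _-Raw-AlmostCommutative⟶_)
open import Data.Empty using (⊥)
open import Data.Fin.Base as Fin using (Fin; zero; suc; punchIn; punchOut)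
import Data.Fin.Properties as Finₚ
open import Data.Integer.Base as ℤ using (ℤ; +_; -[1+_]) hiding (module ℤ)
open import Data.Integer.Divisibility using () renaming (_∣_ to _∣ᶻ_)
import Data.Integer.Properties as ℤₚ
import Data.Integer.Solver as ℤSolvers
open import Data.List.Base using (List; []; _∷_; _++_; cartesianProduct; deduplicate; filter; length; lookup; map; upTo)
open import Data.List.Membership.Propositional using (lose) renaming (_∈_ to _∈ₗ_)
open import Data.List.Membership.Propositional.Properties
  using (∈-++⁺ˡ; ∈-++⁺ʳ; ∈-cartesianProduct⁺; ∈-deduplicate⁺; ∈-deduplicate⁻; ∈-filter⁺; ∈-filter⁻; ∈-lookup; ∈-map⁺; ∈-upTo⁺)
import Data.List.Relation.Unary.All as All
open import Data.List.Relation.Unary.AllPairs using (_∷_)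
open import Data.List.Relation.Unary.Any as Any using (index)
open import Data.List.Relation.Unary.Any.Properties using (lookup-index)
import Data.List.Relation.Unary.Unique.DecPropositional.Properties as Unique
open import Data.List.Relation.Unary.Unique.Propositional using (Unique)
open import Data.Maybe.Base using (just; nothing)
open import Data.Maybe.Relation.Binary.Pointwise using (just; nothing)
open import Data.Nat.Base as ℕ using (ℕ; suc; zero; NonZero; z≤n; s≤s) hiding (module ℕ)
open import Data.Nat.Coprimality as Coprimality using (Coprime; coprime-/gcd; coprime-divisor)
open import Data.Nat.Divisibility using (_∣_; _∣?_; divides; m∣m*n; ∣-refl; ∣-trans; ∣⇒≤)
open import Data.Nat.DivMod using (_/_; _%_; +-distrib-/-∣ʳ; [m+kn]%n≡m%n; m*n/n≡m; m/n*n≡m; m<n⇒m%n≡m; m<n⇒m/n≡0)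
open import Data.Nat.GCD using (gcd; gcd[m,n]∣m; gcd[m,n]∣n; gcd[m,n]≢0)
open import Data.Nat.Logarithm using (⌊log₂_⌋; ⌊log₂⌋-mono-≤; ⌊log₂[2*b]⌋≡1+⌊log₂b⌋; ⌊log₂[2^n]⌋≡n)
open import Data.Nat.Primality using (Prime; prime?)
import Data.Nat.Properties as ℕₚ
open import Data.Nat.Solver using () renaming (module +-*-Solver to ℕSolver)
open import Data.Product.Base using (∃-syntax; _×_; _,_; proj₁; proj₂)
open import Data.Product.Properties using (≡-dec)
open import Data.Rational.Base as ℚ using (mkℚ)
import Data.Rational.Properties as ℚₚ
open import Data.Rational.Unnormalised.Base as ℚᵘ using (mkℚᵘ)
import Data.Rational.Unnormalised.Properties as ℚᵘₚ
open import Data.Sum.Base using (_⊎_; inj₁; inj₂)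
open import Data.Unit.Base using (⊤; tt)
open import Data.Vec.Base as Vec using (Vec; []; _∷_) hiding (module Vec)
import Data.Vec.Properties as Vec
open import Function.Bundles using (Inverse)
open import Level using (0ℓ; Level)
open import Relation.Binary.Bundles using (Setoid)
open import Relation.Binary.Definitions using (DecidableEquality; WeaklyDecidable; tri<; tri≈; tri>)
open import Relation.Binary.PropositionalEquality
  using (_≡_; _≢_; refl; sym; trans; cong; cong₂; subst; subst₂; module ≡-Reasoning)
import Relation.Binary.Reasoning.Setoid as SetoidReasoning
open import Relation.Nullary using (¬_; Dec; yes; no; contradiction)
open import Relation.Nullary.Decidable using (map′; _×-dec_; _→-dec_; ¬?)
open import Relation.Unary using (Pred; _∈_; _⊆_; _≐_)

-- Subgroups are arbitrary predicates on points over `K`, and both counts have to be exhibited as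
-- actual numbers. So it must be decided which curves and kernels occur, although a kernel cannot be
-- inspected. The integer root resolves this: a kernel is extensionally equal to the explicit
-- predicate `pointsOver u`, so kernels are compared through u, and their existence is tested by
-- searching a bounded interval for roots of ψ.
--
-- The facts about groups of order 3 (no element of order 2, doubling equals negation) are read off
-- from polynomial identities for the coordinates in `add`, each certified by the ring solver.
--
-- The logarithm counts the dyadic ranges of max(a, b). Within one range the triples (a, b, n) are
-- numbered injectively below a constant times X^{1/6}, so no harmonic sum has to be estimated.

module ℤSolver where
  open ℤSolvers.+-*-Solver public

  ψₚ : ∀ {k} → Polynomial k → Polynomial k → Polynomial k → Polynomial k
  ψₚ A B x = con (+ 12) :* x :* (x :* x :* x :+ A :* x :+ B) :- t :* t
    where t = x :* x :+ x :* x :+ x :* x :+ A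

-- The 3-division polynomial 3x⁴ + 6Ax² + 12Bx - A², in the form
-- 12 x f(x) - f′(x)² with f the cubic x³ + Ax + B.
ψ : ℤ → ℤ → ℤ → ℤ
ψ A B x = + 12 * x * (x * x * x + A * x + B) - t * t
  where
  open ℤ using (_+_; _*_; _-_)
  t : ℤ
  t = x * x + x * x + x * x + A

-- The embedding of ℤ in ℚ

/1-homo-+ : ∀ m n → (m ℤ.+ n) ℚ./ 1 ≡ m ℚ./ 1 ℚ.+ n ℚ./ 1
/1-homo-+ m n = ℚₚ.toℚᵘ-injective (begin
  ℚ.toℚᵘ ((m ℤ.+ n) ℚ./ 1)                     ≈⟨ ℚₚ.toℚᵘ-fromℚᵘ (mkℚᵘ (m ℤ.+ n) 0) ⟩
  mkℚᵘ (m ℤ.+ n) 0                             ≈⟨ ℚᵘ.*≡* (solve 2 (λ m n →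
    (m :+ n) :* con (+ 1) := (m :* con (+ 1) :+ n :* con (+ 1)) :* con (+ 1)) refl m n) ⟩
  mkℚᵘ m 0 ℚᵘ.+ mkℚᵘ n 0                       ≈⟨ ℚᵘₚ.+-cong (ℚₚ.toℚᵘ-fromℚᵘ (mkℚᵘ m 0)) (ℚₚ.toℚᵘ-fromℚᵘ (mkℚᵘ n 0)) ⟨
  ℚ.toℚᵘ (m ℚ./ 1) ℚᵘ.+ ℚ.toℚᵘ (n ℚ./ 1)       ≈⟨ ℚₚ.toℚᵘ-homo-+ (m ℚ./ 1) (n ℚ./ 1) ⟨
  ℚ.toℚᵘ (m ℚ./ 1 ℚ.+ n ℚ./ 1)                 ∎)
  where
  open SetoidReasoning ℚᵘₚ.≃-setoid
  open ℤSolver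

/1-homo-* : ∀ m n → (m ℤ.* n) ℚ./ 1 ≡ (m ℚ./ 1) ℚ.* (n ℚ./ 1)
/1-homo-* m n = ℚₚ.toℚᵘ-injective (begin
  ℚ.toℚᵘ ((m ℤ.* n) ℚ./ 1)                     ≈⟨ ℚₚ.toℚᵘ-fromℚᵘ (mkℚᵘ (m ℤ.* n) 0) ⟩
  mkℚᵘ m 0 ℚᵘ.* mkℚᵘ n 0                       ≈⟨ ℚᵘₚ.*-cong (ℚₚ.toℚᵘ-fromℚᵘ (mkℚᵘ m 0)) (ℚₚ.toℚᵘ-fromℚᵘ (mkℚᵘ n 0)) ⟨
  ℚ.toℚᵘ (m ℚ./ 1) ℚᵘ.* ℚ.toℚᵘ (n ℚ./ 1)       ≈⟨ ℚₚ.toℚᵘ-homo-* (m ℚ./ 1) (n ℚ./ 1) ⟨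
  ℚ.toℚᵘ ((m ℚ./ 1) ℚ.* (n ℚ./ 1))                 ∎)
  where open SetoidReasoning ℚᵘₚ.≃-setoid

/1-homo-neg : ∀ m → (ℤ.- m) ℚ./ 1 ≡ ℚ.- (m ℚ./ 1)
/1-homo-neg m = ℚₚ.toℚᵘ-injective (begin
  ℚ.toℚᵘ ((ℤ.- m) ℚ./ 1)   ≈⟨ ℚₚ.toℚᵘ-fromℚᵘ (mkℚᵘ (ℤ.- m) 0) ⟩
  ℚᵘ.- mkℚᵘ m 0            ≈⟨ ℚᵘₚ.-‿cong (ℚₚ.toℚᵘ-fromℚᵘ (mkℚᵘ m 0)) ⟨
  ℚᵘ.- ℚ.toℚᵘ (m ℚ./ 1)    ≈⟨ ℚₚ.toℚᵘ-homo‿- (m ℚ./ 1) ⟨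
  ℚ.toℚᵘ (ℚ.- (m ℚ./ 1))   ∎)
  where open SetoidReasoning ℚᵘₚ.≃-setoid

p*↧p≡↥p : ∀ p → p ℚ.* ((ℚ.↧ p) ℚ./ 1) ≡ (ℚ.↥ p) ℚ./ 1
p*↧p≡↥p p@(mkℚ n d-1 _) = ℚₚ.toℚᵘ-injective (begin
  ℚ.toℚᵘ (p ℚ.* ((+ d) ℚ./ 1))               ≈⟨ ℚₚ.toℚᵘ-homo-* p ((+ d) ℚ./ 1) ⟩
  mkℚᵘ n d-1 ℚᵘ.* ℚ.toℚᵘ ((+ d) ℚ./ 1)     ≈⟨ ℚᵘₚ.*-cong ℚᵘₚ.≃-refl (ℚₚ.toℚᵘ-fromℚᵘ (mkℚᵘ (+ d) 0)) ⟩
  mkℚᵘ n d-1 ℚᵘ.* mkℚᵘ (+ d) 0             ≈⟨ ℚᵘ.*≡* (trans (ℤₚ.*-identityʳ _)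
                                                (cong (n ℤ.*_) (cong +_ (sym (ℕₚ.*-identityʳ d))))) ⟩
  mkℚᵘ n 0                                 ≈⟨ ℚₚ.toℚᵘ-fromℚᵘ (mkℚᵘ n 0) ⟨
  ℚ.toℚᵘ (n ℚ./ 1)                         ∎)
  where
  open SetoidReasoning ℚᵘₚ.≃-setoid
  d : ℕ
  d = suc d-1

-- Polynomial identities in a ring that receives ℤ

module WithIntegers
  (R : CommutativeRing 0ℓ 0ℓ) (φ : ℤ → CommutativeRing.Carrier R)
  (φ-hom : RingMorphisms.IsRingHomomorphism ℤ.+-*-rawRing (CommutativeRing.rawRing R) φ)
  where

  open CommutativeRing R hiding (zero) renaming (refl to ≈-refl; sym to ≈-sym; trans to ≈-trans)
  open RingMorphisms.IsRingHomomorphism φ-hom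
  open SetoidReasoning setoid

  private
    morphism : ℤ.+-*-rawRing -Raw-AlmostCommutative⟶ fromCommutativeRing R
    morphism = record
      { ⟦_⟧ = φ ; +-homo = +-homo ; *-homo = *-homo ; -‿homo = -‿homo
      ; 0-homo = 0#-homo ; 1-homo = 1#-homo }

    weaklyDec : WeaklyDecidable (Induced-equivalence morphism)
    weaklyDec m n with m ℤₚ.≟ n
    ... | yes m≡n = just (reflexive (cong φ m≡n))
    ... | no  _   = nothing

  open RingSolver ℤ.+-*-rawRing (fromCommutativeRing R) morphism weaklyDec public
    using (Polynomial; op; con; var; _:^_; :-_; _:+_; _:*_; _:-_; [+]; [*]; ⟦_⟧; solve; _:=_)
  open import Algebra.Properties.Semiring.Exp semiring using (_^_)

  -- Evaluates the solver's syntax in ℤ, so that one induction (`φ-eval`) carries any polynomial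
  -- expression along `φ`; concrete instances such as `φ-ψ` then hold by unfolding.
  evalℤ : ∀ {k} → Polynomial k → Vec ℤ k → ℤ
  evalℤ (op [+] p q) ρ = evalℤ p ρ ℤ.+ evalℤ q ρ
  evalℤ (op [*] p q) ρ = evalℤ p ρ ℤ.* evalℤ q ρ
  evalℤ (con c)      ρ = c
  evalℤ (var i)      ρ = Vec.lookup ρ i
  evalℤ (p :^ k)     ρ = evalℤ p ρ ℤ.^ k
  evalℤ (:- p)       ρ = ℤ.- evalℤ p ρ

  φ-eval : ∀ {k} (p : Polynomial k) ρ → φ (evalℤ p ρ) ≈ ⟦ p ⟧ (Vec.map φ ρ)
  φ-eval (op [+] p q)   ρ = ≈-trans (+-homo _ _) (+-cong (φ-eval p ρ) (φ-eval q ρ))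
  φ-eval (op [*] p q)   ρ = ≈-trans (*-homo _ _) (*-cong (φ-eval p ρ) (φ-eval q ρ))
  φ-eval (con c)        ρ = ≈-refl
  φ-eval (var i)        ρ = reflexive (sym (Vec.lookup-map i φ ρ))
  φ-eval (p :^ zero)    ρ = 1#-homo
  φ-eval (p :^ suc k)   ρ = ≈-trans (*-homo _ _) (*-cong (φ-eval p ρ) (φ-eval (p :^ k) ρ))
  φ-eval (:- p)         ρ = ≈-trans (-‿homo _) (-‿cong (φ-eval p ρ))

  tangentₚ : ∀ {k} → Polynomial k → Polynomial k → Polynomial k
  weierstrassₚ ψₚ : ∀ {k} → Polynomial k → Polynomial k → Polynomial k → Polynomial k
  weierstrassₚ a b x = x :* x :* x :+ a :* x :+ b
  tangentₚ a x = x :* x :+ x :* x :+ x :* x :+ a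
  ψₚ a b x = con (+ 12) :* x :* weierstrassₚ a b x :- tangentₚ a x :* tangentₚ a x

  Δₚ : ∀ {k} → Polynomial k → Polynomial k → Polynomial k
  Δₚ a b = con (+ 4) :* a :^ 3 :+ con (+ 27) :* b :^ 2

  -- The derivative 3x² + a, spelled exactly like the numerator of the tangent slope in `add`, so
  -- that the two agree definitionally.
  tangent : Carrier → Carrier → Carrier
  weierstrass ψᴿ : Carrier → Carrier → Carrier → Carrier
  weierstrass a b x = x * x * x + a * x + b
  tangent a x = x * x + x * x + x * x + a
  ψᴿ a b x = φ (+ 12) * x * weierstrass a b x - tangent a x * tangent a x

  Δᴿ : Carrier → Carrier → Carrier
  Δᴿ a b = φ (+ 4) * a ^ 3 + φ (+ 27) * b ^ 2

  tangent-cong : ∀ {a x x′} → x ≈ x′ → tangent a x ≈ tangent a x′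
  tangent-cong e = +-congʳ (+-cong (+-cong (*-cong e e) (*-cong e e)) (*-cong e e))

  weierstrass-cong : ∀ {a b x x′} → x ≈ x′ → weierstrass a b x ≈ weierstrass a b x′
  weierstrass-cong e = +-congʳ (+-cong (*-cong (*-cong e e) e) (*-congˡ e))

  ψᴿ-cong : ∀ {a b x x′} → x ≈ x′ → ψᴿ a b x ≈ ψᴿ a b x′
  ψᴿ-cong e = +-cong (*-cong (*-congˡ e) (weierstrass-cong e))
                     (-‿cong (*-cong (tangent-cong e) (tangent-cong e)))

  φ-ψ : ∀ A B x → φ (ψ A B x) ≈ ψᴿ (φ A) (φ B) (φ x)
  φ-ψ A B x = φ-eval (ψₚ (var zero) (var (suc zero)) (var (suc (suc zero)))) (A ∷ B ∷ x ∷ [])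

  φ-Δ : ∀ A B → φ (+ 4 ℤ.* A ℤ.^ 3 ℤ.+ + 27 ℤ.* B ℤ.^ 2) ≈ Δᴿ (φ A) (φ B)
  φ-Δ A B = φ-eval (Δₚ (var zero) (var (suc zero))) (A ∷ B ∷ [])

  -- Linear combinations of hypotheses: l ≈ r is derived from p ≈ 0 by
  -- exhibiting l as r + c p for some c.
  vanish₁ : ∀ {l p} c → p ≈ 0# → l ≈ c * p → l ≈ 0#
  vanish₁ {l} {p} c p≈0 e = begin
    l       ≈⟨ e ⟩
    c * p   ≈⟨ *-congˡ p≈0 ⟩
    c * 0#  ≈⟨ zeroʳ c ⟩
    0#      ∎

  vanish₂ : ∀ {l p q} c d → p ≈ 0# → q ≈ 0# → l ≈ c * p + d * q → l ≈ 0#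
  vanish₂ c d p≈0 q≈0 e =
    ≈-trans e (≈-trans (+-cong (vanish₁ c p≈0 ≈-refl) (vanish₁ d q≈0 ≈-refl)) (+-identityʳ 0#))

  vanish₃ : ∀ {l p q r} c d e → p ≈ 0# → q ≈ 0# → r ≈ 0# → l ≈ c * p + d * q + e * r → l ≈ 0#
  vanish₃ c d e p≈0 q≈0 r≈0 l≈ =
    ≈-trans l≈ (≈-trans (+-cong (vanish₂ c d p≈0 q≈0 ≈-refl) (vanish₁ e r≈0 ≈-refl)) (+-identityʳ 0#))

  combine₁ : ∀ {l r p} c → p ≈ 0# → l ≈ r + c * p → l ≈ r
  combine₁ {r = r} c p≈0 e = ≈-trans e (≈-trans (+-congˡ (vanish₁ c p≈0 ≈-refl)) (+-identityʳ r))

  combine₂ : ∀ {l r p q} c d → p ≈ 0# → q ≈ 0# → l ≈ r + (c * p + d * q) → l ≈ r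
  combine₂ {r = r} c d p≈0 q≈0 e =
    ≈-trans e (≈-trans (+-congˡ (vanish₂ c d p≈0 q≈0 ≈-refl)) (+-identityʳ r))

-- Integrality of rational roots of the 3-division polynomial

coprime-*ˡ : ∀ {m n o} → Coprime m o → Coprime n o → Coprime (m ℕ.* n) o
coprime-*ˡ m⊥o n⊥o {k} (k∣mn , k∣o) = n⊥o (coprime-divisor k⊥m k∣mn , k∣o)
  where
  k⊥m : Coprime k _
  k⊥m (j∣k , j∣m) = m⊥o (j∣m , ∣-trans j∣k k∣o)

d²∣3⇒d≡1 : ∀ d → d ℕ.* d ∣ 3 → d ≡ 1
d²∣3⇒d≡1 0 (divides q 3≡q*0) with () ← trans 3≡q*0 (ℕₚ.*-zeroʳ q)
d²∣3⇒d≡1 1 _ = refl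
d²∣3⇒d≡1 (suc (suc d)) d²∣3
  with ℕ.s≤s (ℕ.s≤s (ℕ.s≤s ())) ← ℕₚ.≤-trans (ℕₚ.*-mono-≤ (ℕₚ.m≤m+n 2 d) (ℕₚ.m≤m+n 2 d)) (∣⇒≤ d²∣3)

-- The leading coefficient is 3, so the usual rational root argument would still allow the
-- denominator 3. But ψ has no cubic term, hence d² and not merely d divides 3n⁴, and 3 is
-- squarefree.
d²∣3n⁴⇒d≡1 : ∀ {d n} → Coprime n d → d ℕ.* d ∣ n ℕ.* (n ℕ.* (n ℕ.* (n ℕ.* 3))) → d ≡ 1
d²∣3n⁴⇒d≡1 {d} {n} n⊥d div = d²∣3⇒d≡1 d (cancel (cancel (cancel (cancel div))))
  where
  d⊥n : Coprime d n
  d⊥n = Coprimality.sym n⊥d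
  cancel : ∀ {o} → d ℕ.* d ∣ n ℕ.* o → d ℕ.* d ∣ o
  cancel = coprime-divisor (coprime-*ˡ d⊥n d⊥n)

-- The 3-division polynomial 3x⁴ + 6ax² + 12bx - a² at x = n/d is, up to the
-- factor d⁴, equal to 3n⁴ - d²(…).
cleared-root⇒d≡1 : ∀ A B n d → Coprime ℤ.∣ n ∣ d →
  n ℤ.* (n ℤ.* (n ℤ.* (n ℤ.* + 3))) ≡
    + d ℤ.* + d ℤ.* (A ℤ.* A ℤ.* (+ d ℤ.* + d) ℤ.- + 6 ℤ.* A ℤ.* (n ℤ.* n) ℤ.- + 12 ℤ.* B ℤ.* (n ℤ.* + d)) →
  d ≡ 1
cleared-root⇒d≡1 A B n d n⊥d eq = d²∣3n⁴⇒d≡1 n⊥d (divides ℤ.∣ M ∣ (begin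
  N ℕ.* (N ℕ.* (N ℕ.* (N ℕ.* 3)))                ≡⟨ cong (λ z → N ℕ.* (N ℕ.* (N ℕ.* z))) (ℤₚ.abs-* n (+ 3)) ⟨
  N ℕ.* (N ℕ.* (N ℕ.* ℤ.∣ n ℤ.* + 3 ∣))          ≡⟨ cong (λ z → N ℕ.* (N ℕ.* z)) (ℤₚ.abs-* n _) ⟨
  N ℕ.* (N ℕ.* ℤ.∣ n ℤ.* (n ℤ.* + 3) ∣)          ≡⟨ cong (N ℕ.*_) (ℤₚ.abs-* n _) ⟨
  N ℕ.* ℤ.∣ n ℤ.* (n ℤ.* (n ℤ.* + 3)) ∣          ≡⟨ ℤₚ.abs-* n _ ⟨
  ℤ.∣ n ℤ.* (n ℤ.* (n ℤ.* (n ℤ.* + 3))) ∣        ≡⟨ cong ℤ.∣_∣ eq ⟩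
  ℤ.∣ + d ℤ.* + d ℤ.* M ∣                        ≡⟨ ℤₚ.abs-* (+ d ℤ.* + d) M ⟩
  ℤ.∣ + d ℤ.* + d ∣ ℕ.* ℤ.∣ M ∣                  ≡⟨ cong (ℕ._* ℤ.∣ M ∣) (ℤₚ.abs-* (+ d) (+ d)) ⟩
  d ℕ.* d ℕ.* ℤ.∣ M ∣                            ≡⟨ ℕₚ.*-comm (d ℕ.* d) ℤ.∣ M ∣ ⟩
  ℤ.∣ M ∣ ℕ.* (d ℕ.* d)                          ∎))
  where
  open ≡-Reasoning
  N = ℤ.∣ n ∣
  M = A ℤ.* A ℤ.* (+ d ℤ.* + d) ℤ.- + 6 ℤ.* A ℤ.* (n ℤ.* n) ℤ.- + 12 ℤ.* B ℤ.* (n ℤ.* + d)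

-- Finite setoids enumerated by keys

Unique⇒lookup-injective : ∀ {a} {A : Set a} {xs : List A} → Unique xs → ∀ i j → lookup xs i ≡ lookup xs j → i ≡ j
Unique⇒lookup-injective (_ ∷ _)    zero    zero    _ = refl
Unique⇒lookup-injective (x∉ ∷ _)   zero    (suc j) e = contradiction e (All.lookup x∉ (∈-lookup j))
Unique⇒lookup-injective (x∉ ∷ _)   (suc i) zero    e = contradiction (sym e) (All.lookup x∉ (∈-lookup i))
Unique⇒lookup-injective (_ ∷ uniq) (suc i) (suc j) e = cong suc (Unique⇒lookup-injective uniq i j e)

module _ {a ℓ : Level} (S : Setoid a ℓ) {Key : Set} (_≟_ : DecidableEquality Key) where
  open Setoid S using (Carrier; _≈_)

  -- The cardinality is the length of the duplicate-free list of attained keys. `image?` does two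
  -- jobs: it selects the attained candidates, and its witness is the element standing for a key.
  finite-by-key : (key : Carrier → Key) →
    (∀ s t → s ≈ t → key s ≡ key t) → (∀ s t → key s ≡ key t → s ≈ t) →
    (candidates : List Key) → (∀ s → key s ∈ₗ candidates) →
    (∀ k → Dec (∃[ s ] key s ≡ k)) →
    ∃[ n ] HasCardinality S n
  finite-by-key key key-cong key-injective candidates key∈ image? = length keys , record
    { to = to ; from = from
    ; to-cong = λ { refl → Setoid.refl S }
    ; from-cong = λ {s} {t} s≈t → lookup-injective _ _ (trans (lookup-from s) (trans (key-cong s t s≈t) (sym (lookup-from t))))
    ; inverse =
        (λ { {s} refl → key-injective _ _ (trans (key-to (from s)) (lookup-from s)) }) ,
        (λ {i} {s} s≈toi → lookup-injective _ _ (trans (lookup-from s) (trans (key-cong _ _ s≈toi) (key-to i))))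
    }
    where
    keys : List Key
    keys = deduplicate _≟_ (filter image? candidates)
    lookup-injective = Unique⇒lookup-injective (Unique.deduplicate-! _≟_ (filter image? candidates))
    preimage : ∀ i → ∃[ s ] key s ≡ lookup keys i
    preimage i = proj₂ (∈-filter⁻ image? {xs = candidates} (∈-deduplicate⁻ _≟_ (filter image? candidates) (∈-lookup i)))
    to : Fin (length keys) → Carrier
    to i = proj₁ (preimage i)
    key-to : ∀ i → key (to i) ≡ lookup keys i
    key-to i = proj₂ (preimage i)
    key∈keys : ∀ s → key s ∈ₗ keys
    key∈keys s = ∈-deduplicate⁺ _≟_ (∈-filter⁺ image? (key∈ s) (s , refl))
    from : Carrier → Fin (length keys)
    from s = index (key∈keys s)
    lookup-from : ∀ s → lookup keys (from s) ≡ key s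
    lookup-from s = sym (lookup-index (key∈keys s))

interval : ℕ → List ℤ
-- The lengths differ because `-[1+ k ]` is -(k + 1): the parts are 0, ..., n and -1, ..., -n.
interval n = map +_ (upTo (suc n)) ++ map -[1+_] (upTo n)

∈-interval : ∀ {n} z → ℤ.∣ z ∣ ℕ.≤ n → z ∈ₗ interval n
∈-interval (+ k)      k≤n = ∈-++⁺ˡ (∈-map⁺ +_ (∈-upTo⁺ (s≤s k≤n)))
∈-interval (-[1+ k ]) k<n = ∈-++⁺ʳ _ (∈-map⁺ -[1+_] (∈-upTo⁺ k<n))

-- Squares and products of integers

gcd-split : ∀ m n → n ≢ 0 → ∃[ g ] ∃[ s ] ∃[ e ] (NonZero g × m ≡ s ℕ.* g × n ≡ e ℕ.* g × Coprime s e)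
gcd-split m n n≢0 = gcd m n , m / gcd m n , n / gcd m n , g≢0 ,
  sym (m/n*n≡m (gcd[m,n]∣m m n)) , sym (m/n*n≡m (gcd[m,n]∣n m n)) , coprime-/gcd m n
  where
  instance
    g≢0 : NonZero (gcd m n)
    g≢0 = ℕ.≢-nonZero (gcd[m,n]≢0 m n (inj₂ n≢0))

coprime-square⇒≡1 : ∀ {s e k} → Coprime s e → s ℕ.* s ≡ e ℕ.* e ℕ.* k → e ≡ 1
coprime-square⇒≡1 {s} {e} {k} s⊥e eq = s⊥e
  ( coprime-divisor (Coprimality.sym s⊥e) (divides (e ℕ.* k) (trans eq (solve 2 (λ e k → e :* e :* k := e :* k :* e) refl e k)))
  , ∣-refl)
  where open ℕSolver

-- With m/d = s/e in lowest terms the equation reads s² = e²k, which forces e = 1: an integer that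
-- is a rational square is the square of an integer.
square-quotient : ∀ {m d k} → d ≢ 0 → m ℕ.* m ≡ d ℕ.* d ℕ.* k → ∃[ r ] k ≡ r ℕ.* r
square-quotient {m} {d} {k} d≢0 eq with gcd-split m d d≢0
... | g , s , e , g≢0 , refl , refl , s⊥e = s , (begin
  k              ≡⟨ ℕₚ.*-identityˡ k ⟨
  1 ℕ.* 1 ℕ.* k  ≡⟨ cong (λ e → e ℕ.* e ℕ.* k) (coprime-square⇒≡1 s⊥e reduced) ⟨
  e ℕ.* e ℕ.* k  ≡⟨ reduced ⟨
  s ℕ.* s        ∎)
  where
  open ≡-Reasoning
  open ℕSolver using (solve; _:=_; _:*_)
  instance
    g²≢0 : NonZero (g ℕ.* g)
    g²≢0 = ℕₚ.m*n≢0 g g {{g≢0}} {{g≢0}}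
  reduced : s ℕ.* s ≡ e ℕ.* e ℕ.* k
  reduced = ℕₚ.*-cancelʳ-≡ _ _ (g ℕ.* g) (begin
    s ℕ.* s ℕ.* (g ℕ.* g)        ≡⟨ solve 2 (λ s g → s :* s :* (g :* g) := s :* g :* (s :* g)) refl s g ⟩
    s ℕ.* g ℕ.* (s ℕ.* g)        ≡⟨ eq ⟩
    e ℕ.* g ℕ.* (e ℕ.* g) ℕ.* k  ≡⟨ solve 3 (λ e g k → e :* g :* (e :* g) :* k := e :* e :* k :* (g :* g)) refl e g k ⟩
    e ℕ.* e ℕ.* k ℕ.* (g ℕ.* g)  ∎)

-- Writing p/r = a/b in lowest terms, a divides the other factor of p.
square-product-split : ∀ p q r → p ℕ.* q ≡ r ℕ.* r → ∃[ a ] ∃[ b ] ∃[ n ] (p ≡ a ℕ.* a ℕ.* n × q ≡ b ℕ.* b ℕ.* n)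
-- For p = 0 the hypothesis says nothing about q, so a = 0, b = 1 and n = q are chosen outright.
square-product-split zero q r _ = 0 , 1 , q , refl , sym (ℕₚ.*-identityˡ q)
square-product-split p@(suc _) q r eq with gcd-split r p (λ ())
... | g , b , a , g≢0 , refl , p≡ag , b⊥a =
  factor (coprime-divisor (Coprimality.sym b⊥a) (coprime-divisor (Coprimality.sym b⊥a)
    (divides q (trans (sym aq≡bbg) (ℕₚ.*-comm a q)))))
  where
  open ≡-Reasoning
  open ℕSolver using (solve; _:=_; _:*_)
  instance
    g-nonZero : NonZero g
    g-nonZero = g≢0
    a-nonZero : NonZero a
    a-nonZero = ℕ.≢-nonZero λ { refl → case p≡ag }
      where
      case : ∀ {k} → suc k ≡ 0 → ⊥
      case ()
  aq≡bbg : a ℕ.* q ≡ b ℕ.* (b ℕ.* g)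
  aq≡bbg = ℕₚ.*-cancelʳ-≡ _ _ g (begin
    a ℕ.* q ℕ.* g            ≡⟨ solve 3 (λ a q g → a :* q :* g := a :* g :* q) refl a q g ⟩
    a ℕ.* g ℕ.* q            ≡⟨ cong (ℕ._* q) p≡ag ⟨
    p ℕ.* q                  ≡⟨ eq ⟩
    b ℕ.* g ℕ.* (b ℕ.* g)    ≡⟨ solve 2 (λ b g → b :* g :* (b :* g) := b :* (b :* g) :* g) refl b g ⟩
    b ℕ.* (b ℕ.* g) ℕ.* g    ∎)
  factor : a ∣ g → ∃[ a ] ∃[ b ] ∃[ n ] (p ≡ a ℕ.* a ℕ.* n × q ≡ b ℕ.* b ℕ.* n)
  factor (divides n g≡na) = a , b , n ,
    trans p≡ag (trans (cong (a ℕ.*_) g≡na) (solve 2 (λ a n → a :* (n :* a) := a :* a :* n) refl a n)) ,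
    ℕₚ.*-cancelˡ-≡ _ _ a (begin
      a ℕ.* q                  ≡⟨ aq≡bbg ⟩
      b ℕ.* (b ℕ.* g)          ≡⟨ cong (λ g → b ℕ.* (b ℕ.* g)) g≡na ⟩
      b ℕ.* (b ℕ.* (n ℕ.* a))  ≡⟨ solve 3 (λ a b n → b :* (b :* (n :* a)) := a :* (b :* b :* n)) refl a b n ⟩
      a ℕ.* (b ℕ.* b ℕ.* n)    ∎)

-- The size of a root, and the relation between two roots

-- The triangle inequality for 3u⁴ = A² - (6Au² + 12Bu), which is ψ(u) = 0 expanded.
ψ-root-inequality : ∀ A B u → ψ A B u ≡ + 0 → let α = ℤ.∣ A ∣; β = ℤ.∣ B ∣; U = ℤ.∣ u ∣ in
  3 ℕ.* (U ℕ.* (U ℕ.* (U ℕ.* U))) ℕ.≤ α ℕ.* α ℕ.+ (6 ℕ.* (α ℕ.* (U ℕ.* U)) ℕ.+ 12 ℕ.* (β ℕ.* U))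
ψ-root-inequality A B u ψ≡0 = begin
  3 ℕ.* (U ℕ.* (U ℕ.* (U ℕ.* U)))
    ≡⟨ abs-*-≡ (+ 3) (u ℤ.* (u ℤ.* (u ℤ.* u))) (abs-*-≡ u (u ℤ.* (u ℤ.* u)) (abs-*-≡ u (u ℤ.* u) (ℤₚ.abs-* u u))) ⟨
  ℤ.∣ + 3 ℤ.* (u ℤ.* (u ℤ.* (u ℤ.* u))) ∣
    ≡⟨ cong ℤ.∣_∣ (trans
         (solve 3 (λ A B x → con (+ 3) :* (x :* (x :* (x :* x))) :=
           (con (+ 12) :* x :* (x :* x :* x :+ A :* x :+ B) :- (x :* x :+ x :* x :+ x :* x :+ A) :* (x :* x :+ x :* x :+ x :* x :+ A))
           :+ (A :* A :- (con (+ 6) :* (A :* (x :* x)) :+ con (+ 12) :* (B :* x)))) refl A B u)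
         (trans (cong (ℤ._+ R) ψ≡0) (ℤₚ.+-identityˡ R))) ⟩
  ℤ.∣ R ∣
    ≤⟨ ℤₚ.∣i-j∣≤∣i∣+∣j∣ (A ℤ.* A) _ ⟩
  ℤ.∣ A ℤ.* A ∣ ℕ.+ ℤ.∣ + 6 ℤ.* (A ℤ.* (u ℤ.* u)) ℤ.+ + 12 ℤ.* (B ℤ.* u) ∣
    ≤⟨ ℕₚ.+-monoʳ-≤ ℤ.∣ A ℤ.* A ∣ (ℤₚ.∣i+j∣≤∣i∣+∣j∣ (+ 6 ℤ.* (A ℤ.* (u ℤ.* u))) _) ⟩
  ℤ.∣ A ℤ.* A ∣ ℕ.+ (ℤ.∣ + 6 ℤ.* (A ℤ.* (u ℤ.* u)) ∣ ℕ.+ ℤ.∣ + 12 ℤ.* (B ℤ.* u) ∣)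
    ≡⟨ cong₂ ℕ._+_ (ℤₚ.abs-* A A)
         (cong₂ ℕ._+_ (abs-*-≡ (+ 6) (A ℤ.* (u ℤ.* u)) (abs-*-≡ A (u ℤ.* u) (ℤₚ.abs-* u u)))
           (abs-*-≡ (+ 12) (B ℤ.* u) (ℤₚ.abs-* B u))) ⟩
  α ℕ.* α ℕ.+ (6 ℕ.* (α ℕ.* (U ℕ.* U)) ℕ.+ 12 ℕ.* (β ℕ.* U)) ∎
  where
  open ℕₚ.≤-Reasoning
  open ℤSolver using (solve; _:=_; _:*_; _:+_; _:-_; con)
  α = ℤ.∣ A ∣
  β = ℤ.∣ B ∣
  U = ℤ.∣ u ∣
  R = A ℤ.* A ℤ.- (+ 6 ℤ.* (A ℤ.* (u ℤ.* u)) ℤ.+ + 12 ℤ.* (B ℤ.* u))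
  abs-*-≡ : ∀ i j {k} → ℤ.∣ j ∣ ≡ k → ℤ.∣ i ℤ.* j ∣ ≡ ℤ.∣ i ∣ ℕ.* k
  abs-*-≡ i j e = trans (ℤₚ.abs-* i j) (cong (ℤ.∣ i ∣ ℕ.*_) e)

-- If U > 3Y, then 9α ≤ U² and 27β ≤ U³, and 81 times the hypothesis becomes 243 U⁴ ≤ (1 + 54 + 36)
-- U⁴ = 91 U⁴. With 2Y in place of 3Y this estimate would fail, as 1/16 + 6/4 + 12/8 exceeds 3.
quartic-root-bound : ∀ {Y α β U} → α ℕ.≤ Y ℕ.* Y → β ℕ.≤ Y ℕ.* Y ℕ.* Y →
  3 ℕ.* (U ℕ.* (U ℕ.* (U ℕ.* U))) ℕ.≤ α ℕ.* α ℕ.+ (6 ℕ.* (α ℕ.* (U ℕ.* U)) ℕ.+ 12 ℕ.* (β ℕ.* U)) →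
  U ℕ.≤ 3 ℕ.* Y
quartic-root-bound {Y} {α} {β} {U} α≤ β≤ root≤ = ℕₚ.≮⇒≥ λ 3Y<U → absurd (ℕₚ.<⇒≤ 3Y<U) (ℕ.>-nonZero (ℕₚ.≤-<-trans z≤n 3Y<U))
  where
  open ℕₚ.≤-Reasoning
  open ℕSolver using (solve; _:=_; _:*_; _:+_; con)
  absurd : 3 ℕ.* Y ℕ.≤ U → NonZero U → ⊥
  absurd 3Y≤U U≢0 = contradiction (ℕₚ.*-cancelʳ-≤ 243 91 (U ℕ.* (U ℕ.* (U ℕ.* U))) {{U⁴≢0}} bound) (ℕₚ.<⇒≱ (ℕₚ.m<m+n 91 {152} ℕₚ.0<1+n))
    where
    U⁴≢0 : NonZero (U ℕ.* (U ℕ.* (U ℕ.* U)))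
    U⁴≢0 = ℕₚ.m*n≢0 U _ {{U≢0}} {{ℕₚ.m*n≢0 U _ {{U≢0}} {{ℕₚ.m*n≢0 U U {{U≢0}} {{U≢0}}}}}}
    9α≤U² : 9 ℕ.* α ℕ.≤ U ℕ.* U
    9α≤U² = begin
      9 ℕ.* α                       ≤⟨ ℕₚ.*-monoʳ-≤ 9 α≤ ⟩
      9 ℕ.* (Y ℕ.* Y)               ≡⟨ solve 1 (λ Y → con 9 :* (Y :* Y) := con 3 :* Y :* (con 3 :* Y)) refl Y ⟩
      3 ℕ.* Y ℕ.* (3 ℕ.* Y)         ≤⟨ ℕₚ.*-mono-≤ 3Y≤U 3Y≤U ⟩
      U ℕ.* U                       ∎
    27β≤U³ : 27 ℕ.* β ℕ.≤ U ℕ.* U ℕ.* U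
    27β≤U³ = begin
      27 ℕ.* β                                 ≤⟨ ℕₚ.*-monoʳ-≤ 27 β≤ ⟩
      27 ℕ.* (Y ℕ.* Y ℕ.* Y)
        ≡⟨ solve 1 (λ Y → con 27 :* (Y :* Y :* Y) := con 3 :* Y :* (con 3 :* Y) :* (con 3 :* Y)) refl Y ⟩
      3 ℕ.* Y ℕ.* (3 ℕ.* Y) ℕ.* (3 ℕ.* Y)      ≤⟨ ℕₚ.*-mono-≤ (ℕₚ.*-mono-≤ 3Y≤U 3Y≤U) 3Y≤U ⟩
      U ℕ.* U ℕ.* U                            ∎
    bound : 243 ℕ.* (U ℕ.* (U ℕ.* (U ℕ.* U))) ℕ.≤ 91 ℕ.* (U ℕ.* (U ℕ.* (U ℕ.* U)))
    bound = begin
      243 ℕ.* (U ℕ.* (U ℕ.* (U ℕ.* U)))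
        ≡⟨ ℕₚ.*-assoc 81 3 (U ℕ.* (U ℕ.* (U ℕ.* U))) ⟩
      81 ℕ.* (3 ℕ.* (U ℕ.* (U ℕ.* (U ℕ.* U))))
        ≤⟨ ℕₚ.*-monoʳ-≤ 81 root≤ ⟩
      81 ℕ.* (α ℕ.* α ℕ.+ (6 ℕ.* (α ℕ.* (U ℕ.* U)) ℕ.+ 12 ℕ.* (β ℕ.* U)))
        ≡⟨ solve 3 (λ α β U → con 81 :* (α :* α :+ (con 6 :* (α :* (U :* U)) :+ con 12 :* (β :* U)))
             := con 9 :* α :* (con 9 :* α) :+ (con 54 :* (con 9 :* α :* (U :* U)) :+ con 36 :* (con 27 :* β :* U))) refl α β U ⟩
      9 ℕ.* α ℕ.* (9 ℕ.* α) ℕ.+ (54 ℕ.* (9 ℕ.* α ℕ.* (U ℕ.* U)) ℕ.+ 36 ℕ.* (27 ℕ.* β ℕ.* U))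
        ≤⟨ ℕₚ.+-mono-≤ (ℕₚ.*-mono-≤ 9α≤U² 9α≤U²)
             (ℕₚ.+-mono-≤ (ℕₚ.*-monoʳ-≤ 54 (ℕₚ.*-monoˡ-≤ (U ℕ.* U) 9α≤U²)) (ℕₚ.*-monoʳ-≤ 36 (ℕₚ.*-monoˡ-≤ U 27β≤U³))) ⟩
      U ℕ.* U ℕ.* (U ℕ.* U) ℕ.+ (54 ℕ.* (U ℕ.* U ℕ.* (U ℕ.* U)) ℕ.+ 36 ℕ.* (U ℕ.* U ℕ.* U ℕ.* U))
        ≡⟨ solve 1 (λ U → U :* U :* (U :* U) :+ (con 54 :* (U :* U :* (U :* U)) :+ con 36 :* (U :* U :* U :* U))
             := con 91 :* (U :* (U :* (U :* U)))) refl U ⟩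
      91 ℕ.* (U ℕ.* (U ℕ.* (U ℕ.* U))) ∎

ψ-root-bound : ∀ {Y} A B u → ℤ.∣ A ∣ ℕ.≤ Y ℕ.* Y → ℤ.∣ B ∣ ℕ.≤ Y ℕ.* Y ℕ.* Y → ψ A B u ≡ + 0 → ℤ.∣ u ∣ ℕ.≤ 3 ℕ.* Y
ψ-root-bound {Y} A B u α≤ β≤ ψ≡0 = quartic-root-bound {Y} α≤ β≤ (ψ-root-inequality A B u ψ≡0)

-- B enters ψ(x) only through 12Bx, so it cancels from v ψ(u) - u ψ(v). What remains is divisible by
-- u - v, and the cofactor is S² + 3uv(u - v)².
ψ-two-roots : ∀ A B u v → u ≢ v → ψ A B u ≡ + 0 → ψ A B v ≡ + 0 →
  let S = A ℤ.+ + 3 ℤ.* u ℤ.* v in S ℤ.* S ≡ ℤ.- ((u ℤ.- v) ℤ.* (u ℤ.- v) ℤ.* (+ 3 ℤ.* u ℤ.* v))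
ψ-two-roots A B u v u≢v ψu≡0 ψv≡0 = cancel (ℤₚ.i*j≡0⇒i≡0∨j≡0 (u ℤ.- v) {S ℤ.* S ℤ.+ T} (begin
  (u ℤ.- v) ℤ.* (S ℤ.* S ℤ.+ T)
    ≡⟨ solve 4 (λ A B u v →
         (u :- v) :* ((A :+ con (+ 3) :* u :* v) :* (A :+ con (+ 3) :* u :* v) :+ (u :- v) :* (u :- v) :* (con (+ 3) :* u :* v)) :=
         v :* ψₚ A B u :- u :* ψₚ A B v) refl A B u v ⟩
  v ℤ.* ψ A B u ℤ.- u ℤ.* ψ A B v
    ≡⟨ cong₂ (λ p q → v ℤ.* p ℤ.- u ℤ.* q) ψu≡0 ψv≡0 ⟩
  v ℤ.* + 0 ℤ.- u ℤ.* + 0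
    ≡⟨ solve 2 (λ u v → v :* con (+ 0) :- u :* con (+ 0) := con (+ 0)) refl u v ⟩
  + 0 ∎))
  where
  open ≡-Reasoning
  open ℤSolver using (solve; _:=_; _:*_; _:+_; _:-_; con; ψₚ)
  S T : ℤ
  S = A ℤ.+ + 3 ℤ.* u ℤ.* v
  T = (u ℤ.- v) ℤ.* (u ℤ.- v) ℤ.* (+ 3 ℤ.* u ℤ.* v)
  cancel : u ℤ.- v ≡ + 0 ⊎ S ℤ.* S ℤ.+ T ≡ + 0 → S ℤ.* S ≡ ℤ.- T
  cancel (inj₁ u-v≡0)  = contradiction (ℤₚ.i-j≡0⇒i≡j u v u-v≡0) u≢v
  cancel (inj₂ S²+T≡0) = ℤₚ.i-j≡0⇒i≡j (S ℤ.* S) (ℤ.- T) (trans (cong (ℤ._+_ (S ℤ.* S)) (ℤₚ.neg-involutive T)) S²+T≡0)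

ψ-two-roots-abs : ∀ A B u v → u ≢ v → ψ A B u ≡ + 0 → ψ A B v ≡ + 0 →
  let S = ℤ.∣ A ℤ.+ + 3 ℤ.* u ℤ.* v ∣ in
  S ℕ.* S ≡ ℤ.∣ u ℤ.- v ∣ ℕ.* ℤ.∣ u ℤ.- v ∣ ℕ.* (3 ℕ.* ℤ.∣ u ∣ ℕ.* ℤ.∣ v ∣)
ψ-two-roots-abs A B u v u≢v ψu≡0 ψv≡0 = begin
  ℤ.∣ S ∣ ℕ.* ℤ.∣ S ∣                                      ≡⟨ ℤₚ.abs-* S S ⟨
  ℤ.∣ S ℤ.* S ∣                                            ≡⟨ cong ℤ.∣_∣ (ψ-two-roots A B u v u≢v ψu≡0 ψv≡0) ⟩
  ℤ.∣ ℤ.- (d ℤ.* d ℤ.* (+ 3 ℤ.* u ℤ.* v)) ∣               ≡⟨ ℤₚ.∣-i∣≡∣i∣ (d ℤ.* d ℤ.* (+ 3 ℤ.* u ℤ.* v)) ⟩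
  ℤ.∣ d ℤ.* d ℤ.* (+ 3 ℤ.* u ℤ.* v) ∣                     ≡⟨ ℤₚ.abs-* (d ℤ.* d) (+ 3 ℤ.* u ℤ.* v) ⟩
  ℤ.∣ d ℤ.* d ∣ ℕ.* ℤ.∣ + 3 ℤ.* u ℤ.* v ∣                 ≡⟨ cong₂ ℕ._*_ (ℤₚ.abs-* d d)
      (trans (ℤₚ.abs-* (+ 3 ℤ.* u) v) (cong (ℕ._* ℤ.∣ v ∣) (ℤₚ.abs-* (+ 3) u))) ⟩
  ℤ.∣ d ∣ ℕ.* ℤ.∣ d ∣ ℕ.* (3 ℕ.* ℤ.∣ u ∣ ℕ.* ℤ.∣ v ∣)     ∎
  where
  open ≡-Reasoning
  S = A ℤ.+ + 3 ℤ.* u ℤ.* v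
  d = u ℤ.- v

two-roots-split : ∀ A B u v → u ≢ v → ψ A B u ≡ + 0 → ψ A B v ≡ + 0 →
  ∃[ a ] ∃[ b ] ∃[ n ] (3 ℕ.* ℤ.∣ u ∣ ≡ a ℕ.* a ℕ.* n × ℤ.∣ v ∣ ≡ b ℕ.* b ℕ.* n)
two-roots-split A B u v u≢v ψu≡0 ψv≡0 =
  let r , k≡r² = square-quotient {ℤ.∣ A ℤ.+ + 3 ℤ.* u ℤ.* v ∣} {ℤ.∣ u ℤ.- v ∣} {3 ℕ.* ℤ.∣ u ∣ ℕ.* ℤ.∣ v ∣}
         (λ ∣u-v∣≡0 → u≢v (ℤₚ.i-j≡0⇒i≡j u v (ℤₚ.∣i∣≡0⇒i≡0 ∣u-v∣≡0)))
         (ψ-two-roots-abs A B u v u≢v ψu≡0 ψv≡0)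
  in square-product-split (3 ℕ.* ℤ.∣ u ∣) ℤ.∣ v ∣ r k≡r²

-- Numbering the pairs (a²n, b²n)

_/2^_ _%2^_ : ℕ → ℕ → ℕ
c /2^ i = _/_ c (2 ℕ.^ i) {{ℕₚ.m^n≢0 2 i}}
c %2^ i = _%_ c (2 ℕ.^ i) {{ℕₚ.m^n≢0 2 i}}

module _ (i r q : ℕ) (r<2^i : r ℕ.< 2 ℕ.^ i) where
  private
    d = 2 ℕ.^ i
    instance
      d≢0 : NonZero d
      d≢0 = ℕₚ.m^n≢0 2 i

  %2^-digit : (r ℕ.+ q ℕ.* d) %2^ i ≡ r
  %2^-digit = trans ([m+kn]%n≡m%n r q d) (m<n⇒m%n≡m r<2^i)

  /2^-digit : (r ℕ.+ q ℕ.* d) /2^ i ≡ q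
  /2^-digit = trans (+-distrib-/-∣ʳ r (divides q refl)) (cong₂ ℕ._+_ (m<n⇒m/n≡0 r<2^i) (m*n/n≡m q d))

  digit-< : ∀ {Q} → q ℕ.< Q → r ℕ.+ q ℕ.* d ℕ.< Q ℕ.* d
  digit-< {Q} q<Q = begin-strict
    r ℕ.+ q ℕ.* d  <⟨ ℕₚ.+-monoˡ-< (q ℕ.* d) r<2^i ⟩
    suc q ℕ.* d    ≤⟨ ℕₚ.*-monoˡ-≤ d q<Q ⟩
    Q ℕ.* d        ∎
    where open ℕₚ.≤-Reasoning

dyadic : ∀ m → ∃[ i ] (2 ℕ.^ i ℕ.≤ suc m × suc m ℕ.< 2 ℕ.^ suc i)
dyadic zero = 0 , s≤s z≤n , s≤s (s≤s z≤n)
dyadic (suc m) with dyadic m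
... | i , 2^i≤ , <2^1+i with suc (suc m) ℕₚ.<? 2 ℕ.^ suc i
...   | yes lt = i , ℕₚ.m≤n⇒m≤1+n 2^i≤ , lt
...   | no ≮ = suc i , ℕₚ.≮⇒≥ ≮ , (begin-strict
  suc (suc m)          ≤⟨ <2^1+i ⟩
  2 ℕ.^ suc i          <⟨ ℕₚ.^-monoʳ-< 2 (s≤s (s≤s z≤n)) {suc i} {suc (suc i)} ℕₚ.≤-refl ⟩
  2 ℕ.^ suc (suc i)    ∎)
  where open ℕₚ.≤-Reasoning

-- If 2ⁱ ≤ m < 2ⁱ⁺¹, k ≤ m and m²n ≤ W, the mixed-radix number c with digits
-- n - 1, m - 2ⁱ, k in radices 2ⁱ and 2ⁱ⁺¹ is less than n 2ⁱ 2ⁱ⁺¹ ≤ 2W.  So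
-- (i , c) takes only O(W log W) values.
digits : ℕ → ℕ → ℕ × ℕ × ℕ
digits i c = 2 ℕ.^ i ℕ.+ (c /2^ suc i) %2^ i , c %2^ suc i , suc ((c /2^ suc i) /2^ i)

digits-surjective : ∀ {W} m k n → NonZero m → NonZero n → k ℕ.≤ m → m ℕ.* m ℕ.* n ℕ.≤ W →
  ∃[ i ] ∃[ c ] (i ℕ.< suc ⌊log₂ W ⌋ × c ℕ.< 2 ℕ.* W × digits i c ≡ (m , k , n))
digits-surjective {W} m@(suc m-1) k n@(suc n-1) _ _ k≤m mmn≤W = i , c , s≤s i≤log , c<2W ,
  cong₂ _,_ (trans (cong (λ z → 2 ℕ.^ i ℕ.+ z %2^ i) c/) (trans (cong (2 ℕ.^ i ℕ.+_) (%2^-digit i ρ n-1 ρ<)) (ℕₚ.m+[n∸m]≡n 2^i≤m)))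
    (cong₂ _,_ (%2^-digit (suc i) k c′ k<) (cong suc (trans (cong (_/2^ i) c/) (/2^-digit i ρ n-1 ρ<))))
  where
  open ℕₚ.≤-Reasoning
  open ℕSolver using (solve; _:=_; _:*_; con)
  i : ℕ
  i = proj₁ (dyadic m-1)
  2^i≤m : 2 ℕ.^ i ℕ.≤ m
  2^i≤m = proj₁ (proj₂ (dyadic m-1))
  m<2^1+i : m ℕ.< 2 ℕ.^ suc i
  m<2^1+i = proj₂ (proj₂ (dyadic m-1))
  ρ c′ c : ℕ
  ρ = m ℕ.∸ 2 ℕ.^ i
  c′ = ρ ℕ.+ n-1 ℕ.* 2 ℕ.^ i
  c = k ℕ.+ c′ ℕ.* 2 ℕ.^ suc i
  k< : k ℕ.< 2 ℕ.^ suc i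
  k< = ℕₚ.≤-<-trans k≤m m<2^1+i
  ρ< : ρ ℕ.< 2 ℕ.^ i
  ρ< = ℕₚ.+-cancelˡ-< (2 ℕ.^ i) ρ (2 ℕ.^ i) (begin-strict
    2 ℕ.^ i ℕ.+ ρ            ≡⟨ ℕₚ.m+[n∸m]≡n 2^i≤m ⟩
    m                        <⟨ m<2^1+i ⟩
    2 ℕ.^ i ℕ.+ (2 ℕ.^ i ℕ.+ 0)   ≡⟨ cong (2 ℕ.^ i ℕ.+_) (ℕₚ.+-identityʳ _) ⟩
    2 ℕ.^ i ℕ.+ 2 ℕ.^ i      ∎)
  c/ : c /2^ suc i ≡ c′
  c/ = /2^-digit (suc i) k c′ k<
  c<2W : c ℕ.< 2 ℕ.* W
  c<2W = begin-strict
    c                                             <⟨ digit-< (suc i) k c′ k< (digit-< i ρ n-1 ρ< ℕₚ.≤-refl) ⟩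
    n ℕ.* 2 ℕ.^ i ℕ.* (2 ℕ.* 2 ℕ.^ i)             ≡⟨ solve 2 (λ n p → n :* p :* (con 2 :* p) := con 2 :* (p :* p :* n)) refl n (2 ℕ.^ i) ⟩
    2 ℕ.* (2 ℕ.^ i ℕ.* 2 ℕ.^ i ℕ.* n)             ≤⟨ ℕₚ.*-monoʳ-≤ 2 (ℕₚ.*-monoˡ-≤ n (ℕₚ.*-mono-≤ 2^i≤m 2^i≤m)) ⟩
    2 ℕ.* (m ℕ.* m ℕ.* n)                         ≤⟨ ℕₚ.*-monoʳ-≤ 2 mmn≤W ⟩
    2 ℕ.* W                                       ∎
  i≤log : i ℕ.≤ ⌊log₂ W ⌋
  i≤log = begin
    i                     ≡⟨ ⌊log₂[2^n]⌋≡n i ⟨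
    ⌊log₂ 2 ℕ.^ i ⌋       ≤⟨ ⌊log₂⌋-mono-≤ (begin
      2 ℕ.^ i             ≤⟨ 2^i≤m ⟩
      m                   ≤⟨ ℕₚ.m≤m*n m m ⟩
      m ℕ.* m             ≤⟨ ℕₚ.m≤m*n (m ℕ.* m) n ⟩
      m ℕ.* m ℕ.* n       ≤⟨ mmn≤W ⟩
      W                   ∎) ⟩
    ⌊log₂ W ⌋             ∎

-- In `digits` the larger multiplier comes before the smaller one; the index restores which of the
-- two belongs to the first component.
square-multiples : Fin 2 → ℕ × ℕ × ℕ → ℕ × ℕ
square-multiples zero       (m , k , n) = m ℕ.* m ℕ.* n , k ℕ.* k ℕ.* n
square-multiples (suc zero) (m , k , n) = k ℕ.* k ℕ.* n , m ℕ.* m ℕ.* n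

-- `digits` only yields a positive n and a positive larger multiplier. Both are positive unless the
-- two products vanish together, which is the excluded case; a single vanishing product is covered
-- by k = 0.
square-multiples-encoded : ∀ {W} a b n → a ℕ.* a ℕ.* n ℕ.≤ W → b ℕ.* b ℕ.* n ℕ.≤ W →
  ¬ (a ℕ.* a ℕ.* n ≡ 0 × b ℕ.* b ℕ.* n ≡ 0) →
  ∃[ swap ] ∃[ i ] ∃[ c ] (i ℕ.< suc ⌊log₂ W ⌋ × c ℕ.< 2 ℕ.* W ×
    square-multiples swap (digits i c) ≡ (a ℕ.* a ℕ.* n , b ℕ.* b ℕ.* n))
square-multiples-encoded {W} a b n aan≤W bbn≤W not-both-0 = split (ℕₚ.≤-total b a)
  where
  n≢0 : NonZero n
  n≢0 = ℕ.≢-nonZero λ { refl → not-both-0 (ℕₚ.*-zeroʳ (a ℕ.* a) , ℕₚ.*-zeroʳ (b ℕ.* b)) }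
  split : b ℕ.≤ a ⊎ a ℕ.≤ b → _
  split (inj₁ b≤a) =
    let i , c , i< , c< , e = digits-surjective a b n
          (ℕ.≢-nonZero λ { refl → not-both-0 (refl , cong (λ b → b ℕ.* b ℕ.* n) (ℕₚ.n≤0⇒n≡0 b≤a)) })
          n≢0 b≤a aan≤W
    in zero , i , c , i< , c< , cong (square-multiples zero) e
  split (inj₂ a≤b) =
    let i , c , i< , c< , e = digits-surjective b a n
          (ℕ.≢-nonZero λ { refl → not-both-0 (cong (λ b → b ℕ.* b ℕ.* n) (ℕₚ.n≤0⇒n≡0 a≤b) , refl) })
          n≢0 a≤b bbn≤W
    in suc zero , i , c , i< , c< , cong (square-multiples (suc zero)) e

bit : ℤ → Fin 2
bit (+ _)    = zero
bit -[1+ _ ] = suc zero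

bit-abs-injective : ∀ i j → bit i ≡ bit j → ℤ.∣ i ∣ ≡ ℤ.∣ j ∣ → i ≡ j
bit-abs-injective (+ _)    (+ _)    _ e    = cong +_ e
bit-abs-injective -[1+ _ ] -[1+ _ ] _ refl = refl

square-injective : ∀ m n → m ℕ.* m ≡ n ℕ.* n → m ≡ n
square-injective m n e with ℕₚ.<-cmp m n
... | tri< m<n _ _ = contradiction e (ℕₚ.<⇒≢ (ℕₚ.*-mono-< m<n m<n))
... | tri≈ _ m≡n _ = m≡n
... | tri> _ _ n<m = contradiction (sym e) (ℕₚ.<⇒≢ (ℕₚ.*-mono-< n<m n<m))

-- Codes for a curve with two distinct roots

record TwoRoots : Set where
  field
    A B u v : ℤ
    u≢v     : u ≢ v
    ψu≡0    : ψ A B u ≡ + 0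
    ψv≡0    : ψ A B v ≡ + 0

  -- Its square is determined by u and v (ψ-two-roots), so only its sign is recorded.
  shifted : ℤ
  shifted = A ℤ.+ + 3 ℤ.* u ℤ.* v

-- Three sign bits for u, v and `shifted`, one bit for the order of the multipliers, then the dyadic
-- exponent i and the mixed-radix number c.
codeSize : ℕ → ℕ
codeSize W = 2 ℕ.* (2 ℕ.* (2 ℕ.* (2 ℕ.* (suc ⌊log₂ W ⌋ ℕ.* (2 ℕ.* W)))))

record Encodes {W : ℕ} (code : Fin (codeSize W)) (t : TwoRoots) : Set where
  open TwoRoots t
  field
    swap  : Fin 2
    i     : Fin (suc ⌊log₂ W ⌋)
    c     : Fin (2 ℕ.* W)
    code≡ : code ≡ Fin.combine (bit u) (Fin.combine (bit v) (Fin.combine (bit shifted) (Fin.combine swap (Fin.combine i c))))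
    abs≡  : square-multiples swap (digits (Fin.toℕ i) (Fin.toℕ c)) ≡ (3 ℕ.* ℤ.∣ u ∣ , ℤ.∣ v ∣)

module _ {W : ℕ} (t : TwoRoots) where
  open TwoRoots t

  encode-digits : ∃[ swap ] ∃[ i ] ∃[ c ] (i ℕ.< suc ⌊log₂ W ⌋ × c ℕ.< 2 ℕ.* W ×
      square-multiples swap (digits i c) ≡ (3 ℕ.* ℤ.∣ u ∣ , ℤ.∣ v ∣)) →
    ∃[ code ] Encodes {W} code t
  encode-digits (swap , i , c , i< , c< , abs≡) = _ , record
    { swap = swap ; i = Fin.fromℕ< i< ; c = Fin.fromℕ< c< ; code≡ = refl
    ; abs≡ = trans (cong₂ (λ i c → square-multiples swap (digits i c)) (Finₚ.toℕ-fromℕ< i<) (Finₚ.toℕ-fromℕ< c<)) abs≡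
    }

  encode-split : 3 ℕ.* ℤ.∣ u ∣ ℕ.≤ W → ℤ.∣ v ∣ ℕ.≤ W →
    ∃[ a ] ∃[ b ] ∃[ n ] (3 ℕ.* ℤ.∣ u ∣ ≡ a ℕ.* a ℕ.* n × ℤ.∣ v ∣ ≡ b ℕ.* b ℕ.* n) →
    ∃[ code ] Encodes {W} code t
  encode-split 3u≤W v≤W (a , b , n , 3u≡ , v≡) =
    encode-digits (subst₂ (λ p q → ∃[ swap ] ∃[ i ] ∃[ c ]
        (i ℕ.< suc ⌊log₂ W ⌋ × c ℕ.< 2 ℕ.* W × square-multiples swap (digits i c) ≡ (p , q)))
      (sym 3u≡) (sym v≡)
      (square-multiples-encoded a b n (subst (ℕ._≤ W) 3u≡ 3u≤W) (subst (ℕ._≤ W) v≡ v≤W) λ (e , e′) →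
        u≢v (trans (ℤₚ.∣i∣≡0⇒i≡0 (ℕₚ.*-cancelˡ-≡ ℤ.∣ u ∣ 0 3 (trans 3u≡ e))) (sym (ℤₚ.∣i∣≡0⇒i≡0 (trans v≡ e′))))))

  encode : 3 ℕ.* ℤ.∣ u ∣ ℕ.≤ W → ℤ.∣ v ∣ ℕ.≤ W → ∃[ code ] Encodes {W} code t
  encode 3u≤W v≤W = encode-split 3u≤W v≤W (two-roots-split A B u v u≢v ψu≡0 ψv≡0)

-- ψ is affine in B with slope 12u.
ψ-determines-B : ∀ A B B′ u → u ≢ + 0 → ψ A B u ≡ + 0 → ψ A B′ u ≡ + 0 → B ≡ B′
ψ-determines-B A B B′ u u≢0 e e′ = ℤₚ.i-j≡0⇒i≡j B B′ (cancel (ℤₚ.i*j≡0⇒i≡0∨j≡0 (+ 12 ℤ.* u) (begin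
  + 12 ℤ.* u ℤ.* (B ℤ.- B′)
    ≡⟨ solve 4 (λ A B B′ u → con (+ 12) :* u :* (B :- B′) := ψₚ A B u :- ψₚ A B′ u) refl A B B′ u ⟩
  ψ A B u ℤ.- ψ A B′ u
    ≡⟨ cong₂ ℤ._-_ e e′ ⟩
  + 0 ∎)))
  where
  open ≡-Reasoning
  open ℤSolver using (solve; _:=_; _:*_; _:+_; _:-_; con; ψₚ)
  cancel : + 12 ℤ.* u ≡ + 0 ⊎ B ℤ.- B′ ≡ + 0 → B ℤ.- B′ ≡ + 0
  cancel (inj₂ d≡0) = d≡0
  cancel (inj₁ 12u≡0) with ℤₚ.i*j≡0⇒i≡0∨j≡0 (+ 12) {u} 12u≡0
  ... | inj₂ u≡0 = contradiction u≡0 u≢0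

-- Signs and absolute values give u and v. These give the square of `shifted`, whose sign is in the
-- code, hence A. Finally B is read off from whichever root is nonzero; u and v are distinct, so one
-- of them is.
code-injective : ∀ {W code} s t → Encodes {W} code s → Encodes {W} code t →
  TwoRoots.A s ≡ TwoRoots.A t × TwoRoots.B s ≡ TwoRoots.B t × TwoRoots.v s ≡ TwoRoots.v t
code-injective {W} s t c d = A≡ , B≡ , v≡
  where
  module s = TwoRoots s
  module t = TwoRoots t
  module c = Encodes c
  module d = Encodes d
  e₁ = Finₚ.combine-injective _ _ _ _ (trans (sym c.code≡) d.code≡)
  e₂ = Finₚ.combine-injective _ _ _ _ (proj₂ e₁)
  e₃ = Finₚ.combine-injective _ _ _ _ (proj₂ e₂)
  e₄ = Finₚ.combine-injective c.swap _ d.swap _ (proj₂ e₃)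
  e₅ = Finₚ.combine-injective c.i c.c d.i d.c (proj₂ e₄)
  abs≡ : (3 ℕ.* ℤ.∣ s.u ∣ , ℤ.∣ s.v ∣) ≡ (3 ℕ.* ℤ.∣ t.u ∣ , ℤ.∣ t.v ∣)
  abs≡ = trans (sym c.abs≡) (trans (cong₂ square-multiples (proj₁ e₄)
    (cong₂ (λ i c → digits (Fin.toℕ i) (Fin.toℕ c)) (proj₁ e₅) (proj₂ e₅))) d.abs≡)
  u≡ : s.u ≡ t.u
  u≡ = bit-abs-injective s.u t.u (proj₁ e₁) (ℕₚ.*-cancelˡ-≡ _ _ 3 (cong proj₁ abs≡))
  v≡ : s.v ≡ t.v
  v≡ = bit-abs-injective s.v t.v (proj₁ e₂) (cong proj₂ abs≡)
  S≡ : s.shifted ≡ t.shifted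
  S≡ = bit-abs-injective s.shifted t.shifted (proj₁ e₃) (square-injective _ _ (trans
    (ψ-two-roots-abs s.A s.B s.u s.v s.u≢v s.ψu≡0 s.ψv≡0)
    (trans (cong₂ (λ u v → ℤ.∣ u ℤ.- v ∣ ℕ.* ℤ.∣ u ℤ.- v ∣ ℕ.* (3 ℕ.* ℤ.∣ u ∣ ℕ.* ℤ.∣ v ∣)) u≡ v≡)
    (sym (ψ-two-roots-abs t.A t.B t.u t.v t.u≢v t.ψu≡0 t.ψv≡0)))))
  A≡ : s.A ≡ t.A
  A≡ = GroupProperties.∙-cancelʳ (AbelianGroup.group ℤₚ.+-0-abelianGroup) (+ 3 ℤ.* s.u ℤ.* s.v) s.A t.A
    (trans S≡ (cong₂ (λ u v → t.A ℤ.+ + 3 ℤ.* u ℤ.* v) (sym u≡) (sym v≡)))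
  B≡ : s.B ≡ t.B
  B≡ with s.u ℤₚ.≟ + 0
  ... | no u≢0 = ψ-determines-B s.A s.B t.B s.u u≢0 s.ψu≡0 (subst₂ (λ A u → ψ A t.B u ≡ + 0) (sym A≡) (sym u≡) t.ψu≡0)
  ... | yes u≡0 = ψ-determines-B s.A s.B t.B s.v (λ v≡0 → s.u≢v (trans u≡0 (sym v≡0))) s.ψv≡0
    (subst₂ (λ A v → ψ A t.B v ≡ + 0) (sym A≡) (sym v≡) t.ψv≡0)

-- Integer sixth roots and the number of codes

⌊log₂⌋-2^* : ∀ k n → .{{_ : NonZero n}} → ⌊log₂ (2 ℕ.^ k ℕ.* n) ⌋ ≡ k ℕ.+ ⌊log₂ n ⌋
⌊log₂⌋-2^* zero    n = cong ⌊log₂_⌋ (ℕₚ.*-identityˡ n)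
⌊log₂⌋-2^* (suc k) n = trans (cong ⌊log₂_⌋ (ℕₚ.*-assoc 2 (2 ℕ.^ k) n))
  (trans (⌊log₂[2*b]⌋≡1+⌊log₂b⌋ (2 ℕ.^ k ℕ.* n) {{ℕₚ.m*n≢0 (2 ℕ.^ k) n {{ℕₚ.m^n≢0 2 k}}}}) (cong suc (⌊log₂⌋-2^* k n)))

^-distribʳ-* : ∀ k m n → (m ℕ.* n) ℕ.^ k ≡ m ℕ.^ k ℕ.* n ℕ.^ k
^-distribʳ-* zero    m n = refl
^-distribʳ-* (suc k) m n = trans (cong (m ℕ.* n ℕ.*_) (^-distribʳ-* k m n)) (ℕₚ.[m*n]*[o*p]≡[m*o]*[n*p] m n (m ℕ.^ k) (n ℕ.^ k))

-- An integer substitute for X^{1/6}. The root is increased only when Y⁶ falls below X, and for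
-- positive Y the step costs at most the factor 64 = 2⁶ because Y + 1 ≤ 2Y.
sixth-root : ∀ X → ∃[ Y ] (X ℕ.≤ Y ℕ.^ 6 × Y ℕ.^ 6 ℕ.≤ 64 ℕ.* X)
sixth-root zero = 0 , z≤n , z≤n
sixth-root (suc X) with sixth-root X
... | Y , X≤Y⁶ , Y⁶≤64X with suc X ℕₚ.≤? Y ℕ.^ 6
...   | yes 1+X≤Y⁶ = Y , 1+X≤Y⁶ , ℕₚ.≤-trans Y⁶≤64X (ℕₚ.*-monoʳ-≤ 64 (ℕₚ.n≤1+n X))
...   | no  1+X≰Y⁶ = suc Y , ℕₚ.≤-<-trans X≤Y⁶ (ℕₚ.^-monoˡ-< 6 (ℕₚ.n<1+n Y)) , next Y (ℕₚ.<⇒≤ (ℕₚ.≰⇒> 1+X≰Y⁶))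
  where
  open ℕₚ.≤-Reasoning
  next : ∀ Y → Y ℕ.^ 6 ℕ.≤ suc X → suc Y ℕ.^ 6 ℕ.≤ 64 ℕ.* suc X
  next zero    _ = ℕₚ.≤-trans (ℕₚ.m≤m+n 1 63) (ℕₚ.*-monoʳ-≤ 64 (s≤s z≤n))
  next Y@(suc Y-1) Y⁶≤ = begin
    suc Y ℕ.^ 6           ≤⟨ ℕₚ.^-monoˡ-≤ 6 {suc Y} {2 ℕ.* Y} (begin
      suc Y               ≤⟨ ℕₚ.+-monoˡ-≤ Y (s≤s z≤n) ⟩
      Y ℕ.+ Y             ≡⟨ cong (Y ℕ.+_) (ℕₚ.+-identityʳ Y) ⟨
      2 ℕ.* Y             ∎) ⟩
    (2 ℕ.* Y) ℕ.^ 6       ≡⟨ ^-distribʳ-* 6 2 Y ⟩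
    64 ℕ.* Y ℕ.^ 6        ≤⟨ ℕₚ.*-monoʳ-≤ 64 Y⁶≤ ⟩
    64 ℕ.* suc X          ∎

sixth-power-bound : ∀ N M {D X Y l} → D ℕ.≤ N ℕ.* (Y ℕ.* l) → Y ℕ.^ 6 ℕ.≤ M ℕ.* X →
  D ℕ.^ 6 ℕ.≤ (N ℕ.^ 6 ℕ.* M) ℕ.* (X ℕ.* l ℕ.^ 6)
sixth-power-bound N M {D} {X} {Y} {l} D≤ Y⁶≤ = begin
  D ℕ.^ 6                                   ≤⟨ ℕₚ.^-monoˡ-≤ 6 D≤ ⟩
  (N ℕ.* (Y ℕ.* l)) ℕ.^ 6                   ≡⟨ ^-distribʳ-* 6 N (Y ℕ.* l) ⟩
  N ℕ.^ 6 ℕ.* (Y ℕ.* l) ℕ.^ 6               ≡⟨ cong (N ℕ.^ 6 ℕ.*_) (^-distribʳ-* 6 Y l) ⟩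
  N ℕ.^ 6 ℕ.* (Y ℕ.^ 6 ℕ.* l ℕ.^ 6)         ≤⟨ ℕₚ.*-monoʳ-≤ (N ℕ.^ 6) (ℕₚ.*-monoˡ-≤ (l ℕ.^ 6) Y⁶≤) ⟩
  N ℕ.^ 6 ℕ.* (M ℕ.* X ℕ.* l ℕ.^ 6)         ≡⟨ cong (N ℕ.^ 6 ℕ.*_) (ℕₚ.*-assoc M X (l ℕ.^ 6)) ⟩
  N ℕ.^ 6 ℕ.* (M ℕ.* (X ℕ.* l ℕ.^ 6))       ≡⟨ ℕₚ.*-assoc (N ℕ.^ 6) M (X ℕ.* l ℕ.^ 6) ⟨
  N ℕ.^ 6 ℕ.* M ℕ.* (X ℕ.* l ℕ.^ 6)         ∎
  where open ℕₚ.≤-Reasoning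

m≤m⁶ : ∀ m → m ℕ.≤ m ℕ.^ 6
m≤m⁶ zero      = z≤n
m≤m⁶ m@(suc _) = ℕₚ.m≤m*n m (m ℕ.^ 5) {{ℕₚ.m^n≢0 m 5}}

-- Inside the logarithm the crude estimate Y ≤ Y⁶ ≤ MX is good enough: the constant factors turn
-- into the summand k.
log-bound : ∀ k M X Y → 2 ℕ.≤ X → Y ℕ.^ 6 ℕ.≤ M ℕ.* X → 9 ℕ.* M ℕ.≤ 2 ℕ.^ k →
  ⌊log₂ (9 ℕ.* Y) ⌋ ℕ.≤ k ℕ.+ ⌊log₂ X ⌋
log-bound k M X Y 2≤X Y⁶≤ 9M≤2^k = begin
  ⌊log₂ (9 ℕ.* Y) ⌋             ≤⟨ ⌊log₂⌋-mono-≤ (begin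
    9 ℕ.* Y                     ≤⟨ ℕₚ.*-monoʳ-≤ 9 (ℕₚ.≤-trans (m≤m⁶ Y) Y⁶≤) ⟩
    9 ℕ.* (M ℕ.* X)             ≡⟨ ℕₚ.*-assoc 9 M X ⟨
    9 ℕ.* M ℕ.* X               ≤⟨ ℕₚ.*-monoˡ-≤ X 9M≤2^k ⟩
    2 ℕ.^ k ℕ.* X               ∎) ⟩
  ⌊log₂ (2 ℕ.^ k ℕ.* X) ⌋       ≡⟨ ⌊log₂⌋-2^* k X {{ℕ.>-nonZero (ℕₚ.≤-trans (s≤s z≤n) 2≤X)}} ⟩
  k ℕ.+ ⌊log₂ X ⌋               ∎
  where
  open ℕₚ.≤-Reasoning

-- The four bits and the 2 of `2 ℕ.* W` make 32, and 288 = 32 · 9. Since l ≥ 1, the additive k + 1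
-- is absorbed into the factor k + 2.
codeSize≤ : ∀ k l Y → 1 ℕ.≤ l → ⌊log₂ (9 ℕ.* Y) ⌋ ℕ.≤ k ℕ.+ l → codeSize (9 ℕ.* Y) ℕ.≤ (288 ℕ.* (2 ℕ.+ k)) ℕ.* (Y ℕ.* l)
codeSize≤ k l Y 1≤l log≤ = begin
  codeSize W
    ≡⟨ solve 2 (λ L W → con 2 :* (con 2 :* (con 2 :* (con 2 :* (L :* (con 2 :* W))))) := con 32 :* (L :* W)) refl (suc ⌊log₂ W ⌋) W ⟩
  32 ℕ.* (suc ⌊log₂ W ⌋ ℕ.* W)
    ≤⟨ ℕₚ.*-monoʳ-≤ 32 (ℕₚ.*-monoˡ-≤ W (begin
      suc ⌊log₂ W ⌋                ≤⟨ s≤s log≤ ⟩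
      suc (k ℕ.+ l)                ≡⟨ ℕₚ.+-comm (suc k) l ⟩
      l ℕ.+ suc k                  ≤⟨ ℕₚ.+-monoʳ-≤ l (ℕₚ.m≤m*n (suc k) l {{ℕ.>-nonZero 1≤l}}) ⟩
      (2 ℕ.+ k) ℕ.* l              ∎)) ⟩
  32 ℕ.* ((2 ℕ.+ k) ℕ.* l ℕ.* W)
    ≡⟨ solve 3 (λ k l Y → con 32 :* (k :* l :* (con 9 :* Y)) := con 288 :* k :* (Y :* l)) refl (2 ℕ.+ k) l Y ⟩
  (288 ℕ.* (2 ℕ.+ k)) ℕ.* (Y ℕ.* l) ∎
  where
  open ℕₚ.≤-Reasoning
  open ℕSolver using (solve; _:=_; _:*_; con)
  W = 9 ℕ.* Y

codeSize-bound : ∀ X Y → 2 ℕ.≤ X → Y ℕ.^ 6 ℕ.≤ 64 ℕ.* X →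
  codeSize (9 ℕ.* Y) ℕ.^ 6 ℕ.≤ ((288 ℕ.* 12) ℕ.^ 6 ℕ.* 64) ℕ.* (X ℕ.* ⌊log₂ X ⌋ ℕ.^ 6)
codeSize-bound X Y 2≤X Y⁶≤64X =
  sixth-power-bound (288 ℕ.* 12) 64 {codeSize (9 ℕ.* Y)} {X} {Y} {⌊log₂ X ⌋}
    (codeSize≤ 10 ⌊log₂ X ⌋ Y (⌊log₂⌋-mono-≤ 2≤X)
      -- The exponent 10 is the least k with 9 · 64 = 576 ≤ 2ᵏ, as 1024 = 576 + 448; it also gives
      -- the factor 12 = 2 + 10.
      (log-bound 10 64 X Y 2≤X Y⁶≤64X (ℕₚ.m≤m+n 576 448))) Y⁶≤64X

-- Arithmetic in the algebraic closure

module Kernels (K : AlgebraicClosureOfℚ) where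
  open AlgebraicClosureOfℚ K hiding (zero)
    renaming (refl to ≈-refl; sym to ≈-sym; trans to ≈-trans; setoid to K-setoid)
  open SetoidReasoning K-setoid
  open RingProperties ring using (x∙y⁻¹≈ε⇒x≈y; x≈y⇒x∙y⁻¹≈ε; -0#≈0#; -‿involutive)

  fromℤ-isHomomorphism : RingMorphisms.IsRingHomomorphism ℤ.+-*-rawRing rawRing fromℤ
  fromℤ-isHomomorphism = record
    { isSemiringHomomorphism = record
      { isNearSemiringHomomorphism = record
        { +-isMonoidHomomorphism = record
          { isMagmaHomomorphism = record
            { isRelHomomorphism = record { cong = λ e → reflexive (cong fromℤ e) }
            ; homo = λ m n → ≈-trans (reflexive (cong ι (/1-homo-+ m n))) (ι.+-homo _ _) }
          ; ε-homo = ι.0#-homo }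
        ; *-homo = λ m n → ≈-trans (reflexive (cong ι (/1-homo-* m n))) (ι.*-homo _ _) }
      ; 1#-homo = ι.1#-homo }
    ; -‿homo = λ m → ≈-trans (reflexive (cong ι (/1-homo-neg m))) (ι.-‿homo _) }
    where module ι = RingMorphisms.IsRingHomomorphism ι-isHomomorphism

  open WithIntegers commutativeRing fromℤ fromℤ-isHomomorphism

  -- Characteristic zero: a nonzero integer is invertible in ℚ, so its image is a unit and cannot
  -- vanish unless 1 = 0 in `K`.
  fromℤ≈0⇒≡0 : ∀ n → fromℤ n ≈ 0# → n ≡ + 0
  fromℤ≈0⇒≡0 n φn≈0 with (n ℚ./ 1) ℚₚ.≟ ℚ.0ℚ
  ... | yes n/1≡0 with ℚᵘ.*≡* e ← ℚₚ.fromℚᵘ-injective {mkℚᵘ n 0} {mkℚᵘ (+ 0) 0} n/1≡0 =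
    trans (sym (ℤₚ.*-identityʳ n)) e
  ... | no n/1≢0 = contradiction (begin
    1#                            ≈⟨ ι.1#-homo ⟨
    ι ℚ.1ℚ                        ≈⟨ reflexive (cong ι (ℚₚ.*-inverseʳ (n ℚ./ 1))) ⟨
    ι ((n ℚ./ 1) ℚ.* ℚ.1/ (n ℚ./ 1))  ≈⟨ ι.*-homo _ _ ⟩
    fromℤ n * ι (ℚ.1/ (n ℚ./ 1))  ≈⟨ *-congʳ φn≈0 ⟩
    0# * ι (ℚ.1/ (n ℚ./ 1))       ≈⟨ zeroˡ _ ⟩
    0#                            ∎) 1≉0
    where
    module ι = RingMorphisms.IsRingHomomorphism ι-isHomomorphism
    instance
      n/1-nonZero : ℚ.NonZero (n ℚ./ 1)
      n/1-nonZero = ℚ.≢-nonZero n/1≢0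

  fromℤ-injective : ∀ m n → fromℤ m ≈ fromℤ n → m ≡ n
  fromℤ-injective m n e = ℤₚ.i-j≡0⇒i≡j m n (fromℤ≈0⇒≡0 _
    (≈-trans (φ-eval (var zero :- var (suc zero)) (m ∷ n ∷ [])) (x≈y⇒x∙y⁻¹≈ε e)))

  -- The solver reads `con (+ 1)` as `fromℤ (+ 1)`, which is not definitionally `1#`.
  1ℤ : Carrier
  1ℤ = fromℤ (+ 1)

  *-cancel-0ˡ : ∀ {x y} → ¬ x ≈ 0# → x * y ≈ 0# → y ≈ 0#
  *-cancel-0ˡ {x} {y} x≉0 xy≈0 = begin
    y                ≈⟨ *-identityˡ y ⟨
    1# * y           ≈⟨ *-congʳ (≈-trans (*-comm _ _) (*-inverse x x≉0)) ⟨
    x ⁻¹ * x * y     ≈⟨ *-assoc _ _ _ ⟩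
    x ⁻¹ * (x * y)   ≈⟨ *-congˡ xy≈0 ⟩
    x ⁻¹ * 0#        ≈⟨ zeroʳ _ ⟩
    0#               ∎

  *-cancel-0ʳ : ∀ {x y} → ¬ y ≈ 0# → x * y ≈ 0# → x ≈ 0#
  *-cancel-0ʳ y≉0 xy≈0 = *-cancel-0ˡ y≉0 (≈-trans (*-comm _ _) xy≈0)

  x²≈0⇒x≈0 : ∀ {x} → x * x ≈ 0# → x ≈ 0#
  x²≈0⇒x≈0 {x} x²≈0 with x ≟ 0#
  ... | yes x≈0 = x≈0
  ... | no  x≉0 = *-cancel-0ˡ x≉0 x²≈0

  x+x≈0⇒x≈0 : ∀ {x} → x + x ≈ 0# → x ≈ 0#
  x+x≈0⇒x≈0 {x} 2x≈0 = *-cancel-0ˡ (λ 2≈0 → case (fromℤ≈0⇒≡0 (+ 2) 2≈0))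
    (≈-trans (solve 1 (λ x → con (+ 2) :* x := x :+ x) ≈-refl x) 2x≈0)
    where
    case : + 2 ≡ + 0 → ⊥
    case ()

  x≈-x⇒x≈0 : ∀ {x} → x ≈ - x → x ≈ 0#
  x≈-x⇒x≈0 {x} e = x+x≈0⇒x≈0 (≈-trans (+-congˡ e) (-‿inverseʳ x))

  squares≈⇒± : ∀ {x y} → x * x ≈ y * y → x ≈ y ⊎ x ≈ - y
  squares≈⇒± {x} {y} e with x ≟ y
  ... | yes x≈y = inj₁ x≈y
  ... | no  x≉y = inj₂ (combine₁ 1ℤ
    (*-cancel-0ˡ (λ x-y≈0 → x≉y (x∙y⁻¹≈ε⇒x≈y x y x-y≈0))
      (vanish₁ 1ℤ (x≈y⇒x∙y⁻¹≈ε e)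
        (solve 2 (λ x y → (x :- y) :* (x :+ y) := con (+ 1) :* (x :* x :- y :* y)) ≈-refl x y)))
    (solve 2 (λ x y → x := :- y :+ con (+ 1) :* (x :+ y)) ≈-refl x y))

  rational-root⇒integral : ∀ A B q → ψᴿ (fromℤ A) (fromℤ B) (ι q) ≈ 0# → ∃[ u ] fromℤ u ≈ ι q
  rational-root⇒integral A B q@(mkℚ n d-1 n⊥d) ψ≈0 =
    n , reflexive (cong ι (trans (cong (λ d → (n ℚ./ suc d)) (sym (ℕₚ.suc-injective d≡1))) (ℚₚ.↥p/↧p≡p q)))
    where
    d = suc d-1
    module ι = RingMorphisms.IsRingHomomorphism ι-isHomomorphism
    d≡1 : d ≡ 1
    d≡1 = cleared-root⇒d≡1 A B n d (Coprimality.recompute n⊥d) (fromℤ-injective _ _ (begin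
      _ ≈⟨ φ-eval (n′ :* (n′ :* (n′ :* (n′ :* con (+ 3))))) ρ ⟩
      -- d⁴ψ(x) is the cleared polynomial evaluated at xd in place of n. The difference between the
      -- two evaluations is a multiple of n - xd, and `c` is the quotient.
      _ ≈⟨ combine₂ (c (fromℤ n) (fromℤ (+ d)) (fromℤ A) (fromℤ B) (ι q)) (fromℤ (+ d) * fromℤ (+ d) * (fromℤ (+ d) * fromℤ (+ d)))
             (x≈y⇒x∙y⁻¹≈ε n≈xd) ψ≈0
             (solve 5 (λ n d a b x →
               n :* (n :* (n :* (n :* con (+ 3)))) :=
               d :* d :* (a :* a :* (d :* d) :- con (+ 6) :* a :* (n :* n) :- con (+ 12) :* b :* (n :* d))
               :+ ((con (+ 3) :* (n :+ x :* d) :* (n :* n :+ x :* x :* (d :* d))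
                    :+ con (+ 6) :* a :* (d :* d) :* (n :+ x :* d) :+ con (+ 12) :* b :* (d :* d :* d))
                   :* (n :- x :* d)
                :+ d :* d :* (d :* d) :* ψₚ a b x))
               ≈-refl (fromℤ n) (fromℤ (+ d)) (fromℤ A) (fromℤ B) (ι q)) ⟩
      _ ≈⟨ φ-eval (d′ :* d′ :* (a′ :* a′ :* (d′ :* d′) :- con (+ 6) :* a′ :* (n′ :* n′) :- con (+ 12) :* b′ :* (n′ :* d′))) ρ ⟨
      _ ∎))
      where
      ρ = n ∷ (+ d) ∷ A ∷ B ∷ []
      n′ = var zero
      d′ = var (suc zero)
      a′ = var (suc (suc zero))
      b′ = var (suc (suc (suc zero)))
      c : Carrier → Carrier → Carrier → Carrier → Carrier → Carrier
      c n d a b x = fromℤ (+ 3) * (n + x * d) * (n * n + x * x * (d * d))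
        + fromℤ (+ 6) * a * (d * d) * (n + x * d) + fromℤ (+ 12) * b * (d * d * d)
      n≈xd : fromℤ n ≈ ι q * fromℤ (+ d)
      n≈xd = ≈-trans (reflexive (cong ι (sym (p*↧p≡↥p q)))) (ι.*-homo _ _)

  -- Doubling a point and the 3-division polynomial

  module Curve (E : 𝓔) where
    open 𝓔 E

    a b : Carrier
    a = fromℤ A
    b = fromℤ B

    Δ≉0 : ¬ Δᴿ a b ≈ 0#
    Δ≉0 Δ≈0 = nonsingular (fromℤ≈0⇒≡0 _ (≈-trans (φ-Δ A B) Δ≈0))

    -- The discriminant lies in the ideal generated by f and f′; the multipliers handed to the
    -- solver are an explicit Bézout relation.
    no-double-root : ∀ {x} → weierstrass a b x ≈ 0# → ¬ tangent a x ≈ 0#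
    no-double-root {x} f≈0 g≈0 = Δ≉0 (vanish₂ _ _ f≈0 g≈0
      (solve 3 (λ a b x → Δₚ a b :=
        con (+ 27) :* (b :- x :* x :* x :- a :* x) :* weierstrassₚ a b x
        :+ (con (+ 4) :* a :* a :+ con (+ 15) :* x :* x :* a :+ con (+ 9) :* x :* x :* x :* x) :* tangentₚ a x)
        ≈-refl a b x))

    -- If y = 0 then f(x) = 0, and ψ = 12xf - f′² leaves f′(x)² = 0, so x would be a double root.
    ψ-root⇒y≉0 : ∀ {x y} → ψᴿ a b x ≈ 0# → y * y ≈ weierstrass a b x → ¬ y ≈ 0#
    ψ-root⇒y≉0 {x} {y} ψ≈0 y²≈f y≈0 = no-double-root f≈0 (x²≈0⇒x≈0
      (vanish₂ (fromℤ (+ 12) * x) (- 1ℤ) f≈0 ψ≈0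
        (solve 3 (λ a b x → tangentₚ a x :* tangentₚ a x :=
          con (+ 12) :* x :* weierstrassₚ a b x :+ (:- con (+ 1)) :* ψₚ a b x) ≈-refl a b x)))
      where
      f≈0 = ≈-trans (≈-sym y²≈f) (≈-trans (*-congˡ y≈0) (zeroʳ y))

    slope : Carrier → Carrier → Carrier
    slope x y = tangent a x * (y + y) ⁻¹

    module _ {x y : Carrier} (y²≈f : y * y ≈ weierstrass a b x) (y≉0 : ¬ y ≈ 0#) where
      private
        D = y + y
        m = slope x y
        D²≉0 : ¬ D * D ≈ 0#
        D²≉0 D²≈0 = y≉0 (x+x≈0⇒x≈0 (x²≈0⇒x≈0 D²≈0))
        mD≈g : m * D ≈ tangent a x
        mD≈g = begin
          tangent a x * D ⁻¹ * D    ≈⟨ *-assoc _ _ _ ⟩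
          tangent a x * (D ⁻¹ * D)  ≈⟨ *-congˡ (≈-trans (*-comm _ _) (*-inverse D λ D≈0 → y≉0 (x+x≈0⇒x≈0 D≈0))) ⟩
          tangent a x * 1#          ≈⟨ *-identityʳ _ ⟩
          tangent a x               ∎

        -- The abscissa of 2P minus that of P, cleared of the denominator (2y)²: as 2ym = f′ and y²
        -- = f, the product is f′² - 12xf. Hence 2P has the abscissa of P exactly at the roots of ψ.
        key : (m * m - x - x - x) * (D * D) ≈ - ψᴿ a b x
        key = combine₂ _ _ (x≈y⇒x∙y⁻¹≈ε mD≈g) (x≈y⇒x∙y⁻¹≈ε y²≈f)
          (solve 5 (λ a b x y m → (m :* m :- x :- x :- x) :* ((y :+ y) :* (y :+ y)) :=
            :- ψₚ a b x :+ ((m :* (y :+ y) :+ tangentₚ a x) :* (m :* (y :+ y) :- tangentₚ a x)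
              :+ (con (ℤ.- (+ 12)) :* x) :* (y :* y :- weierstrassₚ a b x)))
            ≈-refl a b x y m)

      doubled-abscissa≈⇒ψ-root : m * m - x - x ≈ x → ψᴿ a b x ≈ 0#
      doubled-abscissa≈⇒ψ-root e = begin
        ψᴿ a b x                             ≈⟨ -‿involutive _ ⟨
        - - ψᴿ a b x                         ≈⟨ -‿cong key ⟨
        - ((m * m - x - x - x) * (D * D))    ≈⟨ -‿cong (*-congʳ (x≈y⇒x∙y⁻¹≈ε e)) ⟩
        - (0# * (D * D))                     ≈⟨ -‿cong (zeroˡ _) ⟩
        - 0#                                 ≈⟨ -0#≈0# ⟩
        0#                                   ∎

      ψ-root⇒doubled-abscissa≈ : ψᴿ a b x ≈ 0# → m * m - x - x ≈ x
      ψ-root⇒doubled-abscissa≈ ψ≈0 = x∙y⁻¹≈ε⇒x≈y _ _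
        (*-cancel-0ʳ D²≉0 (≈-trans key (≈-trans (-‿cong ψ≈0) -0#≈0#)))

    -- The sum of two distinct points of order 2 has as abscissa the third root -x₁ - x₂ of the
    -- cubic, which equals x₁ only if x₁ is a double root.
    no-root-at-minus-double : ∀ {x₁ x₂} → weierstrass a b x₁ ≈ 0# → weierstrass a b x₂ ≈ 0# →
      ¬ x₁ ≈ x₂ → ¬ x₁ + x₁ + x₂ ≈ 0#
    no-root-at-minus-double {x₁} {x₂} f₁≈0 f₂≈0 x₁≉x₂ e = no-double-root f₁≈0
      (*-cancel-0ˡ (λ d → x₁≉x₂ (x∙y⁻¹≈ε⇒x≈y x₁ x₂ d)) (vanish₃ _ _ _ f₁≈0 f₂≈0 e
        (solve 4 (λ a b x₁ x₂ → (x₁ :- x₂) :* tangentₚ a x₁ :=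
          con (+ 1) :* weierstrassₚ a b x₁ :+ con (ℤ.- (+ 1)) :* weierstrassₚ a b x₂
          :+ ((x₁ :- x₂) :* (x₁ :- x₂)) :* (x₁ :+ x₁ :+ x₂)) ≈-refl a b x₁ x₂)))

    -- This and the next two lemmas select a branch of `add` from facts about the coordinates, so
    -- that later arguments need not repeat its case distinction.
    add-tangent : ∀ {x₁ y₁ x₂ y₂} → x₁ ≈ x₂ → ¬ y₁ ≈ - y₂ →
      add K E (aff x₁ y₁) (aff x₂ y₂) ≡ thirdPoint K (slope x₁ y₁) x₁ y₁ x₂
    add-tangent {x₁} {y₁} {x₂} {y₂} x₁≈x₂ y₁≉-y₂ with x₁ ≟ x₂ | y₁ ≟ - y₂
    ... | no x₁≉x₂ | _         = contradiction x₁≈x₂ x₁≉x₂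
    ... | yes _    | yes y₁≈-y₂ = contradiction y₁≈-y₂ y₁≉-y₂
    ... | yes _    | no _       = refl

    add-secant : ∀ {x₁ y₁ x₂ y₂} → ¬ x₁ ≈ x₂ →
      add K E (aff x₁ y₁) (aff x₂ y₂) ≡ thirdPoint K ((y₂ - y₁) * (x₂ - x₁) ⁻¹) x₁ y₁ x₂
    add-secant {x₁} {y₁} {x₂} {y₂} x₁≉x₂ with x₁ ≟ x₂ | y₁ ≟ - y₂
    ... | no _      | _ = refl
    ... | yes x₁≈x₂ | _ = contradiction x₁≈x₂ x₁≉x₂

    add-opposite : ∀ {x₁ y₁ x₂ y₂} → x₁ ≈ x₂ → y₁ ≈ - y₂ → add K E (aff x₁ y₁) (aff x₂ y₂) ≡ ∞
    add-opposite {x₁} {y₁} {x₂} {y₂} x₁≈x₂ y₁≈-y₂ with x₁ ≟ x₂ | y₁ ≟ - y₂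
    ... | no x₁≉x₂ | _          = contradiction x₁≈x₂ x₁≉x₂
    ... | yes _    | no y₁≉-y₂  = contradiction y₁≈-y₂ y₁≉-y₂
    ... | yes _    | yes _      = refl

  neg-square : ∀ y → - y * - y ≈ y * y
  neg-square = solve 1 (λ y → :- y :* :- y := y :* y) ≈-refl

  automorphism-fixes-fromℤ : ∀ σ → IsAutomorphism commutativeRing σ → ∀ n → σ (fromℤ n) ≈ fromℤ n
  automorphism-fixes-fromℤ σ aut = fixℤ
    where
    module σ = RingMorphisms.IsRingIsomorphism aut
    module φ = RingMorphisms.IsRingHomomorphism fromℤ-isHomomorphism
    fixℕ : ∀ n → σ (fromℤ (+ n)) ≈ fromℤ (+ n)
    fixℕ 0 = ≈-trans (σ.⟦⟧-cong φ.0#-homo) (≈-trans σ.0#-homo (≈-sym φ.0#-homo))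
    fixℕ (suc n) = begin
      σ (fromℤ (+ suc n))                    ≈⟨ σ.⟦⟧-cong (φ.+-homo (+ 1) (+ n)) ⟩
      σ (fromℤ (+ 1) + fromℤ (+ n))          ≈⟨ σ.+-homo _ _ ⟩
      σ (fromℤ (+ 1)) + σ (fromℤ (+ n))      ≈⟨ +-cong (≈-trans (σ.⟦⟧-cong φ.1#-homo) (≈-trans σ.1#-homo (≈-sym φ.1#-homo))) (fixℕ n) ⟩
      fromℤ (+ 1) + fromℤ (+ n)              ≈⟨ φ.+-homo (+ 1) (+ n) ⟨
      fromℤ (+ suc n)                        ∎
    fixℤ : ∀ n → σ (fromℤ n) ≈ fromℤ n
    fixℤ (+ n) = fixℕ n
    fixℤ (ℤ.-[1+ n ]) = begin
      σ (fromℤ (ℤ.- + suc n))    ≈⟨ σ.⟦⟧-cong (φ.-‿homo (+ suc n)) ⟩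
      σ (- fromℤ (+ suc n))      ≈⟨ σ.-‿homo _ ⟩
      - σ (fromℤ (+ suc n))      ≈⟨ -‿cong (fixℕ (suc n)) ⟩
      - fromℤ (+ suc n)          ≈⟨ φ.-‿homo (+ suc n) ⟨
      fromℤ (ℤ.- + suc n)        ∎

  square-root : ∀ c → ∃[ y ] y * y ≈ c
  square-root c =
    -- The coefficient list -c, 0 stands for the monic polynomial y² - c.
    let y , e = algebraicallyClosed (- c) (0# ∷ []) in y , (begin
      y * y                ≈⟨ *-congˡ (≈-trans (+-identityˡ _) (*-identityʳ y)) ⟨
      y * (0# + y * 1#)    ≈⟨ x∙y⁻¹≈ε⇒x≈y _ _ (≈-trans (+-comm _ _) e) ⟩
      c                    ∎)

  -- The kernel attached to an integral root

  module _ (E : 𝓔) where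
    open 𝓔 E
    open Curve E

    -- The canonical form of a kernel: it depends only on the coefficients of the curve and on u.
    pointsOver : ℤ → Pred (Point K) 0ℓ
    pointsOver u ∞         = ⊤
    pointsOver u (aff x y) = x ≈ fromℤ u × y * y ≈ weierstrass a b x

    module _ (u : ℤ) (ψ≡0 : ψ A B u ≡ + 0) where
      private
        ψ≈0 : ∀ {x} → x ≈ fromℤ u → ψᴿ a b x ≈ 0#
        ψ≈0 e = ≈-trans (ψᴿ-cong e) (≈-trans (≈-sym (φ-ψ A B u))
          (≈-trans (reflexive (cong fromℤ ψ≡0)) (RingMorphisms.IsRingHomomorphism.0#-homo fromℤ-isHomomorphism)))

      pointsOver-respects : ∀ {P Q} → Setoid._≈_ (Point-setoid K) P Q → P ∈ pointsOver u → Q ∈ pointsOver u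
      pointsOver-respects nothing _ = tt
      pointsOver-respects (just (x≈x′ , y≈y′)) (x≈u , y²≈f) =
        ≈-trans (≈-sym x≈x′) x≈u ,
        ≈-trans (≈-sym (*-cong y≈y′ y≈y′)) (≈-trans y²≈f (weierstrass-cong x≈x′))

      -- Two affine points over u are equal or opposite, so their sum is ∞ or a double; the
      -- vanishing of ψ at u turns doubling into negation.
      add-pointsOver : ∀ {P Q} → P ∈ pointsOver u → Q ∈ pointsOver u → add K E P Q ∈ pointsOver u
      add-pointsOver {∞}       {Q}       P∈ Q∈ = Q∈
      add-pointsOver {aff _ _} {∞}       P∈ Q∈ = P∈
      add-pointsOver {aff x₁ y₁} {aff x₂ y₂} (x₁≈u , y₁²≈f) (x₂≈u , y₂²≈f) = sum∈ (y₁ ≟ - y₂)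
        where
        x₁≈x₂ : x₁ ≈ x₂
        x₁≈x₂ = ≈-trans x₁≈u (≈-sym x₂≈u)
        m x₃ y₃ : Carrier
        m = slope x₁ y₁
        x₃ = m * m - x₁ - x₂
        y₃ = m * (x₁ - x₃) - y₁
        x₃≈x₁ : x₃ ≈ x₁
        x₃≈x₁ = ≈-trans (+-congˡ (-‿cong (≈-sym x₁≈x₂)))
          (ψ-root⇒doubled-abscissa≈ y₁²≈f (ψ-root⇒y≉0 (ψ≈0 x₁≈u) y₁²≈f) (ψ≈0 x₁≈u))
        y₃≈-y₁ : y₃ ≈ - y₁
        y₃≈-y₁ = combine₁ (- m) (x≈y⇒x∙y⁻¹≈ε x₃≈x₁)
          (solve 4 (λ m x₁ x₃ y₁ → m :* (x₁ :- x₃) :- y₁ := :- y₁ :+ (:- m) :* (x₃ :- x₁)) ≈-refl m x₁ x₃ y₁)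
        sum∈ : Dec (y₁ ≈ - y₂) → add K E (aff x₁ y₁) (aff x₂ y₂) ∈ pointsOver u
        sum∈ (yes y₁≈-y₂) = subst (_∈ pointsOver u) (sym (add-opposite x₁≈x₂ y₁≈-y₂)) tt
        sum∈ (no  y₁≉-y₂) = subst (_∈ pointsOver u) (sym (add-tangent x₁≈x₂ y₁≉-y₂)) (≈-trans x₃≈x₁ x₁≈u , (begin
          y₃ * y₃                  ≈⟨ *-cong y₃≈-y₁ y₃≈-y₁ ⟩
          - y₁ * - y₁              ≈⟨ neg-square y₁ ⟩
          y₁ * y₁                  ≈⟨ y₁²≈f ⟩
          weierstrass a b x₁       ≈⟨ weierstrass-cong x₃≈x₁ ⟨
          weierstrass a b x₃       ∎))

      pointsOver-isSubgroup : IsSubgroup K E (pointsOver u)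
      pointsOver-isSubgroup = record
        { respects = pointsOver-respects
        ; onCurve  = λ { {∞} _ → tt ; {aff _ _} (_ , y²≈f) → y²≈f }
        ; ∞∈       = tt
        ; add∈     = add-pointsOver
        ; negate∈  = λ { {∞} _ → tt ; {aff _ y} (x≈u , y²≈f) → x≈u , ≈-trans (neg-square y) y²≈f }
        }

      pointsOver-order3 : HasCardinality (subset-setoid K (pointsOver u)) 3
      pointsOver-order3 = record
        { to = to ; from = from
        ; to-cong = λ { refl → Setoid.refl (Point-setoid K) }
        ; from-cong = λ {P} {Q} → from-cong P Q
        ; inverse = (λ {P} {i} → to∘from P i) , (λ {i} {P} → from∘to i P)
        }
        where
        S = subset-setoid K (pointsOver u)
        x = fromℤ u
        y = proj₁ (square-root (weierstrass a b x))
        y²≈f = proj₂ (square-root (weierstrass a b x))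
        y≉-y : ¬ y ≈ - y
        y≉-y e = ψ-root⇒y≉0 (ψ≈0 ≈-refl) y²≈f (x≈-x⇒x≈0 e)
        to : Fin 3 → Setoid.Carrier S
        to zero             = ∞ , tt
        to (suc zero)       = aff x y , ≈-refl , y²≈f
        to (suc (suc zero)) = aff x (- y) , ≈-refl , ≈-trans (neg-square y) y²≈f
        from : Setoid.Carrier S → Fin 3
        from (∞ , _) = zero
        from (aff _ y′ , _) with y′ ≟ y
        ... | yes _ = suc zero
        -- On the curve y′² = y², so an ordinate different from y can only be -y.
        ... | no _  = suc (suc zero)
        from-cong : ∀ P Q → Setoid._≈_ S P Q → from P ≡ from Q
        from-cong (∞ , _) (∞ , _) _ = refl
        from-cong (aff _ y₁ , _) (aff _ y₂ , _) (just (_ , y₁≈y₂)) with y₁ ≟ y | y₂ ≟ y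
        ... | yes _ | yes _ = refl
        ... | no  _ | no  _ = refl
        ... | yes e | no ¬e = contradiction (≈-trans (≈-sym y₁≈y₂) e) ¬e
        ... | no ¬e | yes e = contradiction (≈-trans y₁≈y₂ e) ¬e
        to∘from : ∀ P i → i ≡ from P → Setoid._≈_ S (to i) P
        to∘from (∞ , _) _ refl = nothing
        to∘from (aff x′ y′ , x′≈x , y′²≈f) _ refl with y′ ≟ y
        ... | yes y′≈y = just (≈-sym x′≈x , ≈-sym y′≈y)
        ... | no  y′≉y with squares≈⇒± (≈-trans y′²≈f (≈-trans (weierstrass-cong x′≈x) (≈-sym y²≈f)))
        ...   | inj₁ y′≈y  = contradiction y′≈y y′≉y
        ...   | inj₂ y′≈-y = just (≈-sym x′≈x , ≈-sym y′≈-y)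
        from∘to : ∀ i P → Setoid._≈_ S P (to i) → from P ≡ i
        from∘to zero (∞ , _) _ = refl
        from∘to (suc zero) (aff _ y′ , _) (just (_ , e)) with y′ ≟ y
        ... | yes _ = refl
        ... | no ¬e = contradiction e ¬e
        from∘to (suc (suc zero)) (aff _ y′ , _) (just (_ , e)) with y′ ≟ y
        ... | yes y′≈y = contradiction (≈-trans (≈-sym y′≈y) e) y≉-y
        ... | no _     = refl

      pointsOver-isGaloisStable : IsGaloisStable K (pointsOver u)
      pointsOver-isGaloisStable σ aut {∞} _ = tt
      pointsOver-isGaloisStable σ aut {aff x y} (x≈u , y²≈f) =
        ≈-trans (σ.⟦⟧-cong x≈u) (fix u) , (begin
          σ y * σ y                                  ≈⟨ σ.*-homo y y ⟨
          σ (y * y)                                  ≈⟨ σ.⟦⟧-cong y²≈f ⟩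
          σ (weierstrass a b x)                      ≈⟨ σ.+-homo _ _ ⟩
          σ (x * x * x + a * x) + σ b                ≈⟨ +-cong (σ.+-homo _ _) (fix B) ⟩
          σ (x * x * x) + σ (a * x) + b              ≈⟨ +-congʳ (+-cong (≈-trans (σ.*-homo _ _) (*-congʳ (σ.*-homo _ _)))
                                                          (≈-trans (σ.*-homo _ _) (*-congʳ (fix A)))) ⟩
          weierstrass a b (σ x)                      ∎)
        where
        module σ = RingMorphisms.IsRingIsomorphism aut
        fix = automorphism-fixes-fromℤ σ aut

      pointsOver-is3IsogenyKernel : Is3IsogenyKernel K E (pointsOver u)
      pointsOver-is3IsogenyKernel = record
        { isSubgroup = pointsOver-isSubgroup
        ; order3 = pointsOver-order3
        ; galoisStable = pointsOver-isGaloisStable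
        }

    -- Every kernel comes from an integral root

    record TwoAffinePoints (C : Pred (Point K) 0ℓ) : Set where
      field
        x₁ y₁ x₂ y₂ : Carrier
        P₁∈   : aff x₁ y₁ ∈ C
        P₂∈   : aff x₂ y₂ ∈ C
        P₁≉P₂ : ¬ (x₁ ≈ x₂ × y₁ ≈ y₂)
        cover : ∀ {x y} → aff x y ∈ C → x ≈ x₁ × y ≈ y₁ ⊎ x ≈ x₂ × y ≈ y₂

    -- `punchIn i₀` runs through the two indices other than that of ∞; by injectivity of `to`, the
    -- points there are affine and distinct.
    affinePoints : ∀ {C} → ∞ ∈ C → HasCardinality (subset-setoid K C) 3 → TwoAffinePoints C
    affinePoints {C} ∞∈ card = record
      { P₁∈ = P₁.∈C ; P₂∈ = P₂.∈C
      ; P₁≉P₂ = λ e → case (Finₚ.punchIn-injective i₀ zero (suc zero)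
          (to-injective (transₚ P₁.≈aff (transₚ (just e) (symₚ P₂.≈aff)))))
      ; cover = cover
      }
      where
      open Inverse card
      open Setoid (Point-setoid K) using () renaming (sym to symₚ; trans to transₚ; _≈_ to _≈ₚ_)
      i₀ = from (∞ , ∞∈)
      case : ∀ {k} {i : Fin k} → Fin.zero ≡ suc i → ⊥
      case ()
      to-injective : ∀ {i j} → proj₁ (to i) ≈ₚ proj₁ (to j) → i ≡ j
      to-injective {i} {j} e = trans (sym (inverseʳ {i} {to i} (Setoid.refl (Point-setoid K)))) (inverseʳ {j} {to i} e)
      to∘from : ∀ P → proj₁ (to (from P)) ≈ₚ proj₁ P
      to∘from P = inverseˡ {P} {from P} refl
      record Affine (i : Fin 3) : Set where
        field
          {x y} : Carrier
          ∈C    : aff x y ∈ C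
          ≈aff  : proj₁ (to i) ≈ₚ aff x y
      affine : ∀ i → i ≢ i₀ → Affine i
      affine i i≢i₀ with to i in eq
      ... | ∞ , _ = contradiction (to-injective (transₚ (subst (λ P → proj₁ P ≈ₚ ∞) (sym eq) nothing) (symₚ (to∘from (∞ , ∞∈))))) i≢i₀
      ... | aff x y , P∈ = record { ∈C = P∈ ; ≈aff = subst (λ P → proj₁ P ≈ₚ aff x y) (sym eq) (Setoid.refl (Point-setoid K)) }
      module P₁ = Affine (affine (punchIn i₀ zero) (Finₚ.punchInᵢ≢i i₀ zero))
      module P₂ = Affine (affine (punchIn i₀ (suc zero)) (Finₚ.punchInᵢ≢i i₀ (suc zero)))
      cover : ∀ {x y} → aff x y ∈ C → x ≈ P₁.x × y ≈ P₁.y ⊎ x ≈ P₂.x × y ≈ P₂.y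
      cover {x} {y} P∈ = go (punchOut i₀≢i) (Finₚ.punchIn-punchOut i₀≢i)
        where
        i = from (aff x y , P∈)
        P≈toi : aff x y ≈ₚ proj₁ (to i)
        P≈toi = symₚ (to∘from (aff x y , P∈))
        i₀≢i : i₀ ≢ i
        i₀≢i i₀≡i with () ← transₚ P≈toi
          (transₚ (subst (λ j → proj₁ (to i) ≈ₚ proj₁ (to j)) (sym i₀≡i) (Setoid.refl (Point-setoid K))) (to∘from (∞ , ∞∈)))
        go : (j : Fin 2) → punchIn i₀ j ≡ i → x ≈ P₁.x × y ≈ P₁.y ⊎ x ≈ P₂.x × y ≈ P₂.y
        go zero e with just p ← transₚ (subst (λ j → aff x y ≈ₚ proj₁ (to j)) (sym e) P≈toi) P₁.≈aff = inj₁ p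
        go (suc zero) e with just p ← transₚ (subst (λ j → aff x y ≈ₚ proj₁ (to j)) (sym e) P≈toi) P₂.≈aff = inj₂ p

    y≈0⇒f≈0 : ∀ {x y} → y * y ≈ weierstrass a b x → y ≈ 0# → weierstrass a b x ≈ 0#
    y≈0⇒f≈0 {y = y} y²≈f y≈0 = ≈-trans (≈-sym y²≈f) (≈-trans (*-congˡ y≈0) (zeroʳ y))

    module _ {C : Pred (Point K) 0ℓ} (isKernel : Is3IsogenyKernel K E C) where
      open Is3IsogenyKernel isKernel
      open IsSubgroup isSubgroup
      open TwoAffinePoints (affinePoints ∞∈ order3)

      -- Otherwise P₁ + P₂ would be a third affine point of C: its abscissa -x₁ - x₂ differs from
      -- both x₁ and x₂.
      not-both-2-torsion : y₁ ≈ 0# → ¬ y₂ ≈ 0#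
      not-both-2-torsion y₁≈0 y₂≈0 = absurd (cover (subst (_∈ C) (add-secant x₁≉x₂) (add∈ P₁∈ P₂∈)))
        where
        x₁≉x₂ : ¬ x₁ ≈ x₂
        x₁≉x₂ e = P₁≉P₂ (e , ≈-trans y₁≈0 (≈-sym y₂≈0))
        f₁≈0 = y≈0⇒f≈0 (onCurve P₁∈) y₁≈0
        f₂≈0 = y≈0⇒f≈0 (onCurve P₂∈) y₂≈0
        m = (y₂ - y₁) * (x₂ - x₁) ⁻¹
        m≈0 : m ≈ 0#
        m≈0 = ≈-trans (*-congʳ (x≈y⇒x∙y⁻¹≈ε (≈-trans y₂≈0 (≈-sym y₁≈0)))) (zeroˡ _)
        absurd : ∀ {A B : Set} → (m * m - x₁ - x₂ ≈ x₁ × A) ⊎ (m * m - x₁ - x₂ ≈ x₂ × B) → ⊥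
        absurd (inj₁ (x₃≈x₁ , _)) = no-root-at-minus-double f₁≈0 f₂≈0 x₁≉x₂
          (vanish₂ _ _ m≈0 (x≈y⇒x∙y⁻¹≈ε x₃≈x₁) (solve 3 (λ m x₁ x₂ → x₁ :+ x₁ :+ x₂ :=
            m :* m :+ con (ℤ.- + 1) :* (m :* m :- x₁ :- x₂ :- x₁)) ≈-refl m x₁ x₂))
        absurd (inj₂ (x₃≈x₂ , _)) = no-root-at-minus-double f₂≈0 f₁≈0 (λ e → x₁≉x₂ (≈-sym e))
          (vanish₂ _ _ m≈0 (x≈y⇒x∙y⁻¹≈ε x₃≈x₂) (solve 3 (λ m x₁ x₂ → x₂ :+ x₂ :+ x₁ :=
            m :* m :+ con (ℤ.- + 1) :* (m :* m :- x₁ :- x₂ :- x₂)) ≈-refl m x₁ x₂))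

      -- If P₁ were its own negative, then -P₂ being P₁ or P₂ would force y₂ = 0 as well.
      y₁≉0 : ¬ y₁ ≈ 0#
      y₁≉0 y₁≈0 with cover (negate∈ P₂∈)
      ... | inj₁ (_ , -y₂≈y₁) = not-both-2-torsion y₁≈0 (begin
        y₂        ≈⟨ -‿involutive y₂ ⟨
        - (- y₂)  ≈⟨ -‿cong (≈-trans -y₂≈y₁ y₁≈0) ⟩
        - 0#      ≈⟨ -0#≈0# ⟩
        0#        ∎)
      ... | inj₂ (_ , -y₂≈y₂) = not-both-2-torsion y₁≈0 (x≈-x⇒x≈0 (≈-sym -y₂≈y₂))

      -- -P₁ lies in C and differs from P₁, so it is P₂, and the two affine points share their
      -- abscissa.
      abscissa≈x₁ : ∀ {x y} → aff x y ∈ C → x ≈ x₁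
      abscissa≈x₁ P∈ with cover P∈ | cover (negate∈ P₁∈)
      ... | inj₁ (x≈x₁ , _) | _                   = x≈x₁
      ... | inj₂ (x≈x₂ , _) | inj₁ (_ , -y₁≈y₁)   = contradiction (x≈-x⇒x≈0 (≈-sym -y₁≈y₁)) y₁≉0
      ... | inj₂ (x≈x₂ , _) | inj₂ (x₁≈x₂ , _)    = ≈-trans x≈x₂ (≈-sym x₁≈x₂)

      -- 2P₁ is an affine point of C, so its abscissa is again x₁.
      ψ-root-x₁ : ψᴿ a b x₁ ≈ 0#
      ψ-root-x₁ = doubled-abscissa≈⇒ψ-root (onCurve P₁∈) y₁≉0
        (abscissa≈x₁ (subst (_∈ C) (add-tangent ≈-refl (λ e → y₁≉0 (x≈-x⇒x≈0 e))) (add∈ P₁∈ P₁∈)))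

      module _ (u : ℤ) (u≈x₁ : fromℤ u ≈ x₁) where
        ψ≡0 : ψ A B u ≡ + 0
        ψ≡0 = fromℤ≈0⇒≡0 (ψ A B u) (≈-trans (φ-ψ A B u) (≈-trans (ψᴿ-cong u≈x₁) ψ-root-x₁))

        kernel⊆pointsOver : ∀ {P} → P ∈ C → P ∈ pointsOver u
        kernel⊆pointsOver {∞}       _  = tt
        kernel⊆pointsOver {aff _ _} P∈ = ≈-trans (abscissa≈x₁ P∈) (≈-sym u≈x₁) , onCurve P∈

        pointsOver⊆kernel : ∀ {P} → P ∈ pointsOver u → P ∈ C
        pointsOver⊆kernel {∞}       _            = ∞∈
        pointsOver⊆kernel {aff x y} (x≈u , y²≈f) = ±∈ (squares≈⇒± (begin
          y * y                ≈⟨ y²≈f ⟩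
          weierstrass a b x    ≈⟨ weierstrass-cong x≈x₁ ⟩
          weierstrass a b x₁   ≈⟨ onCurve P₁∈ ⟨
          y₁ * y₁              ∎))
          where
          x≈x₁ = ≈-trans x≈u u≈x₁
          ±∈ : y ≈ y₁ ⊎ y ≈ - y₁ → aff x y ∈ C
          ±∈ (inj₁ y≈y₁)  = respects (just (≈-sym x≈x₁ , ≈-sym y≈y₁)) P₁∈
          ±∈ (inj₂ y≈-y₁) = respects (just (≈-sym x≈x₁ , ≈-sym y≈-y₁)) (negate∈ P₁∈)

      abstract
        -- An automorphism moves P₁ within C, where every affine point has abscissa x₁. So x₁ is
        -- fixed by all of them, hence rational, hence integral as a root of ψ.
        kernel-root : ∃[ u ] (ψ A B u ≡ + 0 × C ≐ pointsOver u)
        kernel-root =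
          let q , q≈x₁ = galois x₁ (λ σ aut → abscissa≈x₁ (galoisStable σ aut P₁∈))
              u , u≈q  = rational-root⇒integral A B q (≈-trans (ψᴿ-cong q≈x₁) ψ-root-x₁)
              u≈x₁     = ≈-trans u≈q q≈x₁
          in u , ψ≡0 u u≈x₁ , (kernel⊆pointsOver u u≈x₁ , pointsOver⊆kernel u u≈x₁)

-- Bounds from the height, and decidability of membership in `𝓔`

abs-^ : ∀ i n → ℤ.∣ i ℤ.^ n ∣ ≡ ℤ.∣ i ∣ ℕ.^ n
abs-^ i zero    = refl
abs-^ i (suc n) = trans (ℤₚ.abs-* i (i ℤ.^ n)) (cong (ℤ.∣ i ∣ ℕ.*_) (abs-^ i n))

coefficient-bound : ∀ {z X} c k .{{_ : ℕ.NonZero c}} .{{_ : ℕ.NonZero k}} →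
  ℤ.∣ + c ℤ.* z ℤ.^ k ∣ ℕ.≤ X → ∀ Z → X ℕ.≤ Z ℕ.^ k → ℤ.∣ z ∣ ℕ.≤ Z
coefficient-bound {z} {X} c k cz≤X Z X≤ = ℕₚ.≮⇒≥ λ Z<z → ℕₚ.<⇒≱ (ℕₚ.^-monoˡ-< k Z<z) (begin
  ℤ.∣ z ∣ ℕ.^ k              ≤⟨ ℕₚ.m≤n*m (ℤ.∣ z ∣ ℕ.^ k) c ⟩
  c ℕ.* ℤ.∣ z ∣ ℕ.^ k        ≡⟨ trans (ℤₚ.abs-* (+ c) (z ℤ.^ k)) (cong (c ℕ.*_) (abs-^ z k)) ⟨
  ℤ.∣ + c ℤ.* z ℤ.^ k ∣      ≤⟨ cz≤X ⟩
  X                          ≤⟨ X≤ ⟩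
  Z ℕ.^ k                    ∎)
  where open ℕₚ.≤-Reasoning

module _ (E : 𝓔) {X Y : ℕ} (ht≤X : ht E ℕ.≤ X) (X≤Y⁶ : X ℕ.≤ Y ℕ.^ 6) where
  open 𝓔 E
  open ℕSolver using (solve; _:=_; _:*_; _:^_)

  A-bound : ℤ.∣ A ∣ ℕ.≤ Y ℕ.* Y
  A-bound = coefficient-bound {A} 4 3 (ℕₚ.m⊔n≤o⇒m≤o _ _ ht≤X) (Y ℕ.* Y)
    (subst (X ℕ.≤_) (solve 1 (λ Y → Y :^ 6 := (Y :* Y) :^ 3) refl Y) X≤Y⁶)

  B-bound : ℤ.∣ B ∣ ℕ.≤ Y ℕ.* Y ℕ.* Y
  B-bound = coefficient-bound {B} 27 2 (ℕₚ.m⊔n≤o⇒n≤o _ _ ht≤X) (Y ℕ.* Y ℕ.* Y)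
    (subst (X ℕ.≤_) (solve 1 (λ Y → Y :^ 6 := (Y :* Y :* Y) :^ 2) refl Y) X≤Y⁶)

ht-cong : ∀ E E′ → coefficients E ≡ coefficients E′ → ht E ≡ ht E′
ht-cong E E′ = cong λ (A , B) → ℤ.∣ + 4 ℤ.* A ℤ.^ 3 ∣ ℕ.⊔ ℤ.∣ + 27 ℤ.* B ℤ.^ 2 ∣

power-divisor-≤ : ∀ {ℓ z} k .{{_ : ℕ.NonZero k}} → z ≢ + 0 → (+ ℓ) ℤ.^ k ∣ᶻ z → ℓ ℕ.≤ ℤ.∣ z ∣
power-divisor-≤ {ℓ} {z} (suc k) z≢0 ℓᵏ∣z = ∣⇒≤ {{ℕ.≢-nonZero λ ∣z∣≡0 → z≢0 (ℤₚ.∣i∣≡0⇒i≡0 ∣z∣≡0)}}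
  (∣-trans (subst (ℓ ∣_) (sym (abs-^ (+ ℓ) (suc k))) (m∣m*n (ℓ ℕ.^ k))) ℓᵏ∣z)

module _ (A B : ℤ) where
  Nonsingular Minimal : Set
  Nonsingular = + 4 ℤ.* A ℤ.^ 3 ℤ.+ + 27 ℤ.* B ℤ.^ 2 ≢ + 0
  Minimal = ∀ ℓ → Prime ℓ → ¬ ((+ ℓ) ℤ.^ 4 ∣ᶻ A × (+ ℓ) ℤ.^ 6 ∣ᶻ B)

  -- Nonsingularity excludes A = B = 0, so an offending prime divides a nonzero coefficient and is
  -- at most |A| + |B|. This leaves finitely many primes to test.
  minimal? : Nonsingular → Dec Minimal
  minimal? Δ≢0 = map′ everywhere (λ min {ℓ} _ → min ℓ)
    (ℕₚ.allUpTo? (λ ℓ → prime? ℓ →-dec ¬? ((_ ∣? _) ×-dec (_ ∣? _))) (suc (ℤ.∣ A ∣ ℕ.+ ℤ.∣ B ∣)))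
    where
    small : ∀ {ℓ} → (+ ℓ) ℤ.^ 4 ∣ᶻ A × (+ ℓ) ℤ.^ 6 ∣ᶻ B → ℓ ℕ.≤ ℤ.∣ A ∣ ℕ.+ ℤ.∣ B ∣
    small (ℓ⁴∣A , ℓ⁶∣B) with A ℤₚ.≟ + 0 | B ℤₚ.≟ + 0
    ... | no A≢0  | _        = ℕₚ.≤-trans (power-divisor-≤ 4 A≢0 ℓ⁴∣A) (ℕₚ.m≤m+n _ _)
    ... | yes _   | no B≢0   = ℕₚ.≤-trans (power-divisor-≤ 6 B≢0 ℓ⁶∣B) (ℕₚ.m≤n+m _ _)
    ... | yes A≡0 | yes B≡0  = contradiction (cong₂ (λ A B → + 4 ℤ.* A ℤ.^ 3 ℤ.+ + 27 ℤ.* B ℤ.^ 2) A≡0 B≡0) Δ≢0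
    everywhere : (∀ {ℓ} → ℓ ℕ.< suc (ℤ.∣ A ∣ ℕ.+ ℤ.∣ B ∣) → Prime ℓ → ¬ ((+ ℓ) ℤ.^ 4 ∣ᶻ A × (+ ℓ) ℤ.^ 6 ∣ᶻ B)) → Minimal
    everywhere min ℓ ℓ-prime div = min (s≤s (small div)) ℓ-prime div

  curve? : Dec (∃[ E ] coefficients E ≡ (A , B))
  curve? with (+ 4 ℤ.* A ℤ.^ 3 ℤ.+ + 27 ℤ.* B ℤ.^ 2) ℤₚ.≟ + 0
  ... | yes Δ≡0 = no λ { (E , refl) → 𝓔.nonsingular E Δ≡0 }
  ... | no  Δ≢0 = map′ (λ min → record { A = A ; B = B ; nonsingular = Δ≢0 ; minimal = min } , refl)
                       (λ { (E , refl) → 𝓔.minimal E }) (minimal? Δ≢0)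

-- Comparing cardinalities

module _ {a ℓ : Level} {S : Setoid a ℓ} {n : ℕ} (S-card : HasCardinality S n) where
  private
    module S = Setoid S
  open Inverse S-card

  to-injective : ∀ {i j} → to i S.≈ to j → i ≡ j
  to-injective {i} {j} e = trans (sym (inverseʳ {i} {to i} S.refl)) (inverseʳ {j} {to i} e)

  -- A relation instead of a map of setoids: the place may depend on the representative, since only
  -- the representatives `to i` are ever placed.
  cardinality-≤ : ∀ {m} (P : S.Carrier → Fin m → Set) → (∀ s → ∃[ i ] P s i) →
    (∀ {s t i} → P s i → P t i → s S.≈ t) → n ℕ.≤ m
  cardinality-≤ P place P-injective = Finₚ.injective⇒≤ {f = λ i → proj₁ (place (to i))} λ {i} {j} e →
    to-injective (P-injective (proj₂ (place (to i))) (subst (P (to j)) (sym e) (proj₂ (place (to j)))))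

-- Counting curves and kernels

module Counting (K : AlgebraicClosureOfℚ) where
  open AlgebraicClosureOfℚ K using (_≈_; _*_; commutativeRing; fromℤ) renaming (refl to ≈-refl)
  open Kernels K
  open WithIntegers commutativeRing fromℤ fromℤ-isHomomorphism using (weierstrass)

  module _ (E : 𝓔) {C : Pred (Point K) 0ℓ} (k : Is3IsogenyKernel K E C) where
    open 𝓔 E

    root : ℤ
    root = proj₁ (kernel-root E k)

    root-ψ : ψ A B root ≡ + 0
    root-ψ = proj₁ (proj₂ (kernel-root E k))

    kernel≐pointsOver-root : C ≐ pointsOver E root
    kernel≐pointsOver-root = proj₂ (proj₂ (kernel-root E k))

    root-bound : ∀ {X Y} → ht E ℕ.≤ X → X ℕ.≤ Y ℕ.^ 6 → ℤ.∣ root ∣ ℕ.≤ 3 ℕ.* Y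
    root-bound {X} {Y} ht≤X X≤Y⁶ = ψ-root-bound {Y} A B root (A-bound E {X} {Y} ht≤X X≤Y⁶) (B-bound E {X} {Y} ht≤X X≤Y⁶) root-ψ

  -- Square roots exist in `K`, so there is an affine point of E over u; its abscissa is u, and by
  -- the inclusion also v.
  pointsOver-injective : ∀ E E′ {u v} → pointsOver E u ⊆ pointsOver E′ v → u ≡ v
  pointsOver-injective E E′ {u} {v} u⊆v = fromℤ-injective u v (proj₁ (u⊆v {aff (fromℤ u) _}
    (≈-refl , proj₂ (square-root (weierstrass (fromℤ (𝓔.A E)) (fromℤ (𝓔.B E)) (fromℤ u))))))

  pointsOver-cong : ∀ E E′ {u} → coefficients E ≡ coefficients E′ → pointsOver E u ⊆ pointsOver E′ u
  pointsOver-cong E E′ e {∞}       _            = tt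
  pointsOver-cong E E′ e {aff x y} (x≈u , y²≈f) =
    x≈u , subst (λ (A , B) → y * y ≈ weierstrass (fromℤ A) (fromℤ B) x) e y²≈f

  root-cong : ∀ E E′ {C C′} (k : Is3IsogenyKernel K E C) (k′ : Is3IsogenyKernel K E′ C′) → C ⊆ C′ → root E k ≡ root E′ k′
  root-cong E E′ k k′ C⊆C′ = pointsOver-injective E E′ λ {P} P∈ →
    proj₁ (kernel≐pointsOver-root E′ k′) {P} (C⊆C′ {P} (proj₂ (kernel≐pointsOver-root E k) {P} P∈))

  kernel-⊆ : ∀ E E′ {C C′} (k : Is3IsogenyKernel K E C) (k′ : Is3IsogenyKernel K E′ C′) →
    coefficients E ≡ coefficients E′ → root E k ≡ root E′ k′ → C ⊆ C′
  kernel-⊆ E E′ k k′ e r {P} P∈C = proj₂ (kernel≐pointsOver-root E′ k′) {P}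
    (subst (λ u → P ∈ pointsOver E′ u) r (pointsOver-cong E E′ e {P} (proj₁ (kernel≐pointsOver-root E k) {P} P∈C)))

  module _ (X : ℕ) where
    private
      module Curves = Setoid (CurvesWith3Isogeny K X)
      module Isogenies = Setoid (3Isogenies K X)

    curveKey : Curves.Carrier → ℤ × ℤ
    curveKey (E , _) = coefficients E

    isogenyKey : Isogenies.Carrier → ℤ × ℤ × ℤ
    isogenyKey ((E , C) , _ , k) = 𝓔.A E , 𝓔.B E , root E k

    domain : Isogenies.Carrier → Curves.Carrier
    domain ((E , C) , ht≤X , k) = E , ht≤X , C , k

    isogenyKey-cong : ∀ s t → s Isogenies.≈ t → isogenyKey s ≡ isogenyKey t
    isogenyKey-cong ((E , C) , _ , k) ((E′ , C′) , _ , k′) (e , C≐C′) =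
      cong₂ _,_ (cong proj₁ e) (cong₂ _,_ (cong proj₂ e) (root-cong E E′ k k′ (proj₁ C≐C′)))

    isogenyKey-injective : ∀ s t → isogenyKey s ≡ isogenyKey t → s Isogenies.≈ t
    isogenyKey-injective ((E , C) , _ , k) ((E′ , C′) , _ , k′) e = coef≡ ,
      (kernel-⊆ E E′ k k′ coef≡ root≡ , kernel-⊆ E′ E k′ k (sym coef≡) (sym root≡))
      where
      coef≡ : coefficients E ≡ coefficients E′
      coef≡ = cong (λ (A , B , _) → A , B) e
      root≡ : root E k ≡ root E′ k′
      root≡ = cong (λ (_ , _ , u) → u) e

    -- An existential over arbitrary predicates becomes decidable: (A, B, u) is attained exactly
    -- when (A, B) belongs to `𝓔`, the height is at most X and ψ vanishes at u, with `pointsOver` as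
    -- the kernel.
    isogenyKey? : ∀ k → Dec (∃[ s ] isogenyKey s ≡ k)
    isogenyKey? (A , B , u) = go (curve? A B)
      where
      go : Dec (∃[ E ] coefficients E ≡ (A , B)) → Dec (∃[ s ] isogenyKey s ≡ (A , B , u))
      go (no ∄E) = no λ (((E , _) , _) , e) → ∄E (E , cong (λ (A , B , _) → A , B) e)
      go (yes (E , refl)) = map′
        (λ (ht≤X , ψ≡0) → let k = pointsOver-is3IsogenyKernel E u ψ≡0 in
          ((E , pointsOver E u) , ht≤X , k) ,
          cong (λ u → A , B , u) (sym (pointsOver-injective E E (proj₁ (kernel≐pointsOver-root E k)))))
        (λ (((E′ , _) , ht≤X , k) , e) →
          subst (ℕ._≤ X) (ht-cong E′ E (cong (λ (A , B , _) → A , B) e)) ht≤X ,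
          subst (λ (A , B , u) → ψ A B u ≡ + 0) e (root-ψ E′ k))
        ((ht E ℕₚ.≤? X) ×-dec (ψ A B u ℤₚ.≟ + 0))

    -- A wasteful sixth root of X, sufficient for finiteness; the size estimate uses the sharper Z
    -- below.
    Y : ℕ
    Y = suc X

    X≤Y⁶ : X ℕ.≤ Y ℕ.^ 6
    X≤Y⁶ = ℕₚ.≤-trans (ℕₚ.n≤1+n X) (m≤m⁶ Y)

    -- The roots are at most 3Y in absolute value, so the existence of a kernel is a finite search
    -- for u.
    curveKey? : ∀ k → Dec (∃[ s ] curveKey s ≡ k)
    curveKey? (A , B) = map′
      (λ any → let u , s , e = Any.satisfied {P = λ u → ∃[ s ] isogenyKey s ≡ (A , B , u)} any in
         domain s , cong (λ (A , B , _) → A , B) e)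
      (λ { ((E , ht≤X , C , k) , refl) →
        lose (∈-interval (root E k) (root-bound E k {X} {Y} ht≤X X≤Y⁶)) (((E , C) , ht≤X , k) , refl) })
      (Any.any? (λ u → isogenyKey? (A , B , u)) (interval (3 ℕ.* Y)))

    curves-finite : ∃[ n ] HasCardinality (CurvesWith3Isogeny K X) n
    curves-finite = finite-by-key (CurvesWith3Isogeny K X) (≡-dec ℤₚ._≟_ ℤₚ._≟_) curveKey (λ _ _ e → e) (λ _ _ e → e)
      (cartesianProduct (interval (Y ℕ.* Y)) (interval (Y ℕ.* Y ℕ.* Y)))
      (λ (E , ht≤X , _) → ∈-cartesianProduct⁺ (∈-interval (𝓔.A E) (A-bound E {X} {Y} ht≤X X≤Y⁶))
        (∈-interval (𝓔.B E) (B-bound E {X} {Y} ht≤X X≤Y⁶)))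
      curveKey?

    isogenies-finite : ∃[ n ] HasCardinality (3Isogenies K X) n
    isogenies-finite = finite-by-key (3Isogenies K X) (≡-dec ℤₚ._≟_ (≡-dec ℤₚ._≟_ ℤₚ._≟_))
      isogenyKey isogenyKey-cong isogenyKey-injective
      (cartesianProduct (interval (Y ℕ.* Y)) (cartesianProduct (interval (Y ℕ.* Y ℕ.* Y)) (interval (3 ℕ.* Y))))
      (λ ((E , _) , ht≤X , k) → ∈-cartesianProduct⁺ (∈-interval (𝓔.A E) (A-bound E {X} {Y} ht≤X X≤Y⁶))
        (∈-cartesianProduct⁺ (∈-interval (𝓔.B E) (B-bound E {X} {Y} ht≤X X≤Y⁶))
        (∈-interval (root E k) (root-bound E k {X} {Y} ht≤X X≤Y⁶))))
      isogenyKey?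

    module _ {n₃ n₃′ : ℕ} (curves : HasCardinality (CurvesWith3Isogeny K X) n₃)
             (isogenies : HasCardinality (3Isogenies K X) n₃′) where
      private
        module c = Inverse curves
        module i = Inverse isogenies

      curves≤isogenies : n₃ ℕ.≤ n₃′
      curves≤isogenies = cardinality-≤ curves (λ (E , _) j → coefficients E ≡ coefficients (proj₁ (proj₁ (i.to j))))
        (λ (E , ht≤X , C , k) → let s = (E , C) , ht≤X , k in i.from s , sym (proj₁ (i.inverseˡ {s} {i.from s} refl)))
        (λ e e′ → trans e (sym e′))

      module _ {Z : ℕ} (X≤Z⁶ : X ℕ.≤ Z ℕ.^ 6) where
        canonicalRoot : Fin n₃ → ℤ
        canonicalRoot j = let E , _ , _ , k = c.to j in root E k

        -- An isogeny is counted either by its domain, when its kernel is the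
        -- one chosen by the enumeration of the curves, or by the code of the
        -- pair (chosen root, own root).
        Place : Isogenies.Carrier → Fin n₃ ⊎ Fin (codeSize (9 ℕ.* Z)) → Set
        Place s@((E , _) , _ , k) (inj₁ j) = coefficients E ≡ coefficients (proj₁ (c.to j)) × root E k ≡ canonicalRoot j
        Place s (inj₂ code) = ∃[ t ] (Encodes {9 ℕ.* Z} code t × isogenyKey s ≡ (TwoRoots.A t , TwoRoots.B t , TwoRoots.v t))

        place : ∀ s → ∃[ p ] Place s p
        place s@((E , C) , ht≤X , k) = go (root E k ℤₚ.≟ canonicalRoot j)
          where
          open 𝓔 E
          j = c.from (domain s)
          E₀ = proj₁ (c.to j)
          k₀ = proj₂ (proj₂ (proj₂ (c.to j)))
          coef≡ : coefficients E₀ ≡ coefficients E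
          coef≡ = c.inverseˡ {domain s} {j} refl
          go : Dec (root E k ≡ canonicalRoot j) → ∃[ p ] Place s p
          go (yes e) = inj₁ j , sym coef≡ , e
          go (no ≢)  = code-place (encode t 3u≤9Z v≤9Z)
            where
            t : TwoRoots
            t = record { A = A ; B = B ; u = canonicalRoot j ; v = root E k ; u≢v = λ e → ≢ (sym e)
                       ; ψu≡0 = subst (λ (A , B) → ψ A B (canonicalRoot j) ≡ + 0) coef≡ (root-ψ E₀ k₀)
                       ; ψv≡0 = root-ψ E k }
            -- Roots are bounded by 3Z and the code stores 3|u|, whence the common bound 9Z.
            3u≤9Z : 3 ℕ.* ℤ.∣ canonicalRoot j ∣ ℕ.≤ 9 ℕ.* Z
            3u≤9Z = subst (3 ℕ.* ℤ.∣ canonicalRoot j ∣ ℕ.≤_) (sym (ℕₚ.*-assoc 3 3 Z))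
              (ℕₚ.*-monoʳ-≤ 3 (root-bound E₀ k₀ {X} {Z} (proj₁ (proj₂ (c.to j))) X≤Z⁶))
            v≤9Z : ℤ.∣ root E k ∣ ℕ.≤ 9 ℕ.* Z
            v≤9Z = ℕₚ.≤-trans (root-bound E k {X} {Z} ht≤X X≤Z⁶) (ℕₚ.*-monoˡ-≤ Z (ℕₚ.m≤m+n 3 6))
            code-place : ∃[ code ] Encodes {9 ℕ.* Z} code t → ∃[ p ] Place s p
            code-place (code , enc) = inj₂ code , t , enc , refl

        place-injective : ∀ {s t} p → Place s p → Place t p → s Isogenies.≈ t
        place-injective {s} {t} (inj₁ j) (e , r) (e′ , r′) = isogenyKey-injective s t
          (cong₂ (λ (A , B) u → A , B , u) (trans e (sym e′)) (trans r (sym r′)))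
        place-injective {s} {t} (inj₂ code) (t₁ , enc₁ , e₁) (t₂ , enc₂ , e₂) = isogenyKey-injective s t
          (let A≡ , B≡ , v≡ = code-injective t₁ t₂ enc₁ enc₂
           in trans e₁ (trans (cong₂ _,_ A≡ (cong₂ _,_ B≡ v≡)) (sym e₂)))

        isogenies≤curves+codes : n₃′ ℕ.≤ n₃ ℕ.+ codeSize (9 ℕ.* Z)
        isogenies≤curves+codes = cardinality-≤ isogenies (λ s i → Place s (Fin.splitAt n₃ i))
          (λ s → let p , P = place s in Fin.join n₃ _ p , subst (Place s) (sym (Finₚ.splitAt-join n₃ _ p)) P)
          (λ {s} {t} {i} → place-injective {s} {t} (Fin.splitAt n₃ i))

proposition2p10 : (K : AlgebraicClosureOfℚ) →
    ∃[ N₃ ] ∃[ N₃′ ]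
    ((X : ℕ) → HasCardinality (CurvesWith3Isogeny K X) (N₃ X)) ×
    ((X : ℕ) → HasCardinality (3Isogenies K X) (N₃′ X)) ×
    N₃′ ≈ N₃ +O[X^1/6·logX]
proposition2p10 K = (λ X → proj₁ (curves-finite X)) , (λ X → proj₁ (isogenies-finite X)) ,
  (λ X → proj₂ (curves-finite X)) , (λ X → proj₂ (isogenies-finite X)) ,
  -- The threshold 2 ensures ⌊log₂ X⌋ ≥ 1, which absorbs the additive constants; the 64 is the loss
  -- in `sixth-root`.
  (288 ℕ.* 12) ℕ.^ 6 ℕ.* 64 , 2 , bound
  where
  open Counting K
  bound : ∀ X → 2 ℕ.≤ X → ℕ.∣ proj₁ (isogenies-finite X) - proj₁ (curves-finite X) ∣ ℕ.^ 6 ℕ.≤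
            (288 ℕ.* 12) ℕ.^ 6 ℕ.* 64 ℕ.* (X ℕ.* ⌊log₂ X ⌋ ℕ.^ 6)
  bound X 2≤X = from-root (sixth-root X)
    where
    open ℕₚ.≤-Reasoning
    n₃ = proj₁ (curves-finite X)
    n₃′ = proj₁ (isogenies-finite X)
    n₃≤n₃′ : n₃ ℕ.≤ n₃′
    n₃≤n₃′ = curves≤isogenies X (proj₂ (curves-finite X)) (proj₂ (isogenies-finite X))
    from-root : ∃[ Z ] (X ℕ.≤ Z ℕ.^ 6 × Z ℕ.^ 6 ℕ.≤ 64 ℕ.* X) →
      ℕ.∣ n₃′ - n₃ ∣ ℕ.^ 6 ℕ.≤ (288 ℕ.* 12) ℕ.^ 6 ℕ.* 64 ℕ.* (X ℕ.* ⌊log₂ X ⌋ ℕ.^ 6)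
    from-root (Z , X≤Z⁶ , Z⁶≤64X) = ℕₚ.≤-trans (ℕₚ.^-monoˡ-≤ 6 (begin
      ℕ.∣ n₃′ - n₃ ∣            ≡⟨ ℕₚ.m≤n⇒∣n-m∣≡n∸m n₃≤n₃′ ⟩
      n₃′ ℕ.∸ n₃                ≤⟨ ℕₚ.m≤n+o⇒m∸n≤o n₃′ n₃
        (isogenies≤curves+codes X (proj₂ (curves-finite X)) (proj₂ (isogenies-finite X)) {Z} X≤Z⁶) ⟩
      codeSize (9 ℕ.* Z)        ∎)) (codeSize-bound X Z 2≤X Z⁶≤64X)
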